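{- Let $m\geqslant 2$ be an integer and let $G$ be a finite group of order $q$. Then the adjacency matrix of the diagonal graph $\Gamma_D(G,m)$ has, for each $k\in\{0,\ldots,m-1\}$, eigenvalue $-(m+1)+kq$ with multiplicity \[ \binom{m+1}{k}\,q^{ -1}(q-1)\bigl((q-1)^{m-k}-(-1)^{m-k}\bigr), \] and eigenvalue $(m+1)(q-1)$ with multiplicity $1$. These are all the eigenvalues (where a value whose stated multiplicity is $0$ is not an eigenvalue).
   Context: Diagonal graph: for a group $G$ and an integer $m\geqslant 1$, let $\Omega=G^m$. For $1\leqslant i\leqslant m$, let $Q_i$ be the partition of $\Omega$ in which $(g_1,\ldots,g_m)$ and $(h_1,\ldots,h_m)$ are in the same part if and only if $g_j=h_j$ for all $j\neq i$. Let $Q_0$ be the partition in which $(g_1,\ldots,g_m)$ and $(h_1,\ldots,h_m)$ are in the same part if and only if there is $x\in G$ with $h_i=xg_i$ for all $i$. The diagonal graph $\Gamma_D(G,m)$ is the simple graph with vertex set $\Omega$ in which two distinct vertices are adjacent if and only if they lie in the same part of at least one of $Q_0,Q_1,\ldots,Q_m$. -}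

module Defs where

open import Algebra.Bundles using (Group; CommutativeRing)
open import Algebra.Apartness.Bundles using (HeytingField; HeytingCommutativeRing)
open import Data.Bool.Base using (if_then_else_)
open import Data.Fin.Base using (Fin; zero; suc; combine; finToFun; funToFin)
open import Data.Fin.Properties
  using (any?; all?; _≟_; nonZeroIndex; finToFun-funToFin; funToFin-finToFin)
open import Data.Nat.Base as ℕ using (ℕ; zero; suc; NonZero)
open import Data.Nat.Combinatorics using (_C_)
open import Data.Product.Base using (∃-syntax; _×_; _,_; map₂)
open import Data.Sum.Base as Sum using (_⊎_)
open import Data.Rational.Base using (ℚ; _/_)
open import Data.Vec.Functional using (Vector)
import Data.Vec.Functional.Relation.Binary.Equality.Setoid as VecEq
open import Function.Base using (_∘_)
open import Function.Bundles using (Inverse)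
import Function.Construct.Symmetry as Symmetry
open import Function.Properties.Inverse using (Inverse⇒Injection)
open import Level using (Level; _⊔_) renaming (suc to lsuc)
open import Relation.Binary.Bundles using (Setoid)
open import Relation.Binary.Core using (Rel)
open import Relation.Binary.Definitions
  using (Decidable; Symmetric; Irreflexive; _Respects₂_)
open import Relation.Binary.Structures using (IsEquivalence)
open import Relation.Binary.PropositionalEquality.Core as ≡ using (_≡_; _≢_; _≗_)
import Relation.Binary.PropositionalEquality.Properties as ≡
import Relation.Binary.Reasoning.Setoid as SetoidReasoning
open import Relation.Nullary.Decidable
  using (does; map′; ¬?; _×-dec_; _⊎-dec_; _→-dec_; via-injection)
open import Relation.Nullary.Negation using (¬_)

private
  variable
    a c g ℓ ℓ₁ ℓ₂ r : Level

Enumeration : Setoid a ℓ → ℕ → Set (a ⊔ ℓ)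
Enumeration S n = Inverse (≡.setoid (Fin n)) S

HasOrder : Group g ℓ → ℕ → Set (g ⊔ ℓ)
HasOrder G q = Enumeration (Group.setoid G) q

module _ (S : Setoid a ℓ) where

  open Setoid S renaming (Carrier to V)

  record SimpleGraph r : Set (a ⊔ ℓ ⊔ lsuc r) where
    infix 4 _~_
    field
      _~_      : Rel V r
      ~-resp-≈ : _~_ Respects₂ _≈_
      ~-sym    : Symmetric _~_
      ~-irrefl : Irreflexive _≈_ _~_

private
  funToFin-cong : ∀ {m n} {f h : Fin m → Fin n} → f ≗ h → funToFin f ≡ funToFin h
  funToFin-cong {zero}  p = ≡.refl
  funToFin-cong {suc m} p = ≡.cong₂ combine (p zero) (funToFin-cong (p ∘ suc))

-- Linear algebra over a Heyting field.  Classically every field is one, with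
-- x # y meaning x ≢ y, so ℝ and ℂ are covered; the library has no real numbers.
module Matrices (F : HeytingField c ℓ₁ ℓ₂) where

  open HeytingField F
  open HeytingCommutativeRing heytingCommutativeRing
    using (commutativeRing)
  open CommutativeRing commutativeRing using (+-monoid)

  open import Algebra.Properties.Monoid.Sum +-monoid using (sum)
  open import Algebra.Properties.Monoid.Mult +-monoid
    using () renaming (_×_ to _·ℕ_)
  open VecEq setoid using (_≋_)

  ⟦_⟧ : ℕ → Carrier
  ⟦ n ⟧ = n ·ℕ 1#

  -- With apartness rather than inequality, so that every suc n is invertible.
  CharacteristicZero : Set ℓ₂
  CharacteristicZero = ∀ n → ⟦ suc n ⟧ # 0#

  SquareMatrix : ℕ → Set c
  SquareMatrix n = Fin n → Fin n → Carrier

  𝟎 : ∀ {n} → Vector Carrier n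
  𝟎 _ = 0#

  infixr 7 _*ᵥ_ _·_

  _*ᵥ_ : ∀ {n} → SquareMatrix n → Vector Carrier n → Vector Carrier n
  (A *ᵥ v) i = sum λ j → A i j * v j

  _·_ : ∀ {n} → Carrier → Vector Carrier n → Vector Carrier n
  (x · v) i = x * v i

  linearCombination : ∀ {d n} → Vector Carrier d →
                      Vector (Vector Carrier n) d → Vector Carrier n
  linearCombination x b i = sum λ j → x j * b j i

  LinearlyIndependent : ∀ {d n} → Vector (Vector Carrier n) d → Set (c ⊔ ℓ₁)
  LinearlyIndependent b = ∀ x → linearCombination x b ≋ 𝟎 → x ≋ 𝟎

  HasDimension : ∀ {p n} → (Vector Carrier n → Set p) → ℕ → Set (c ⊔ ℓ₁ ⊔ p)
  HasDimension {n = n} W d = ∃[ b ]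
      (∀ (j : Fin d) → W (b j))
    × LinearlyIndependent {d} {n} b
    × (∀ v → W v → ∃[ x ] v ≋ linearCombination x b)

  Eigenspace : ∀ {n} → SquareMatrix n → Carrier → Vector Carrier n → Set ℓ₁
  Eigenspace A μ v = A *ᵥ v ≋ μ · v

  IsEigenvalue : ∀ {n} → SquareMatrix n → Carrier → Set (c ⊔ ℓ₁)
  IsEigenvalue A μ = ∃[ v ] ¬ (v ≋ 𝟎) × Eigenspace A μ v

  -- The geometric multiplicity (for a real symmetric matrix, such as an adjacency
  -- matrix, also the algebraic one); it is 0 exactly when μ is not an eigenvalue.
  HasMultiplicity : ∀ {n} → SquareMatrix n → Carrier → ℕ → Set (c ⊔ ℓ₁)
  HasMultiplicity A μ d = HasDimension (Eigenspace A μ) d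

  adjacencyMatrix : {S : Setoid a ℓ} (Γ : SimpleGraph S r) →
                    Decidable (SimpleGraph._~_ Γ) →
                    ∀ {n} → Enumeration S n → SquareMatrix n
  adjacencyMatrix Γ _~?_ e i j =
    if does (Inverse.to e i ~? Inverse.to e j) then 1# else 0#

module Diagonal (G : Group g ℓ) (m : ℕ) where

  open Group G
  open VecEq setoid using (_≋_; ≋-setoid; ≋-refl; ≋-sym; ≋-trans)

  Ω : Setoid g ℓ
  Ω = ≋-setoid m

  open Setoid Ω public using () renaming (Carrier to Point)

  -- "Lie in the same part of Q₀", and of Qᵢ; the latter are indexed from zero.
  Q₀ : Rel Point (g ⊔ ℓ)
  Q₀ x y = ∃[ t ] ∀ i → y i ≈ t ∙ x i

  Q : Fin m → Rel Point ℓ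
  Q i x y = ∀ j → j ≢ i → x j ≈ y j

  Q₀-isEquivalence : IsEquivalence Q₀
  Q₀-isEquivalence = record
    { refl  = ε , λ i → sym (identityˡ _)
    ; sym   = λ { (t , p) → t ⁻¹ , λ i → sym (begin
        t ⁻¹ ∙ _        ≈⟨ ∙-congˡ (p i) ⟩
        t ⁻¹ ∙ (t ∙ _)  ≈⟨ assoc _ _ _ ⟨
        t ⁻¹ ∙ t ∙ _    ≈⟨ ∙-congʳ (inverseˡ t) ⟩
        ε ∙ _           ≈⟨ identityˡ _ ⟩
        _               ∎) }
    ; trans = λ { (t , p) (u , q) → u ∙ t , λ i →
        trans (q i) (trans (∙-congˡ (p i)) (sym (assoc _ _ _))) }
    } where open SetoidReasoning setoid

  Q-isEquivalence : ∀ i → IsEquivalence (Q i)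
  Q-isEquivalence i = record
    { refl  = λ j _ → refl
    ; sym   = λ p j j≢i → sym (p j j≢i)
    ; trans = λ p q j j≢i → trans (p j j≢i) (q j j≢i)
    }

  infix 4 _~_

  _~_ : Rel Point (g ⊔ ℓ)
  x ~ y = ¬ (x ≋ y) × (Q₀ x y ⊎ ∃[ i ] Q i x y)

  private
    module Q₀ = IsEquivalence Q₀-isEquivalence
    module Q i = IsEquivalence (Q-isEquivalence i)

    ≋⇒Q₀ : ∀ {x y} → x ≋ y → Q₀ x y
    ≋⇒Q₀ p = ε , λ i → trans (sym (p i)) (sym (identityˡ _))

    ~-sym : Symmetric _~_
    ~-sym (x≉y , s) = x≉y ∘ ≋-sym , Sum.map Q₀.sym (map₂ (λ {i} → Q.sym i)) s

    ~-respʳ : ∀ {x y z} → y ≋ z → x ~ y → x ~ z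
    ~-respʳ y≋z (x≉y , s) =
      (λ x≋z → x≉y (≋-trans x≋z (≋-sym y≋z))) ,
      Sum.map (λ p → Q₀.trans p (≋⇒Q₀ y≋z))
              (map₂ (λ p j j≢i → trans (p j j≢i) (y≋z j))) s

  diagonalGraph : SimpleGraph Ω (g ⊔ ℓ)
  diagonalGraph = record
    { _~_      = _~_
    ; ~-resp-≈ = ~-respʳ , λ y≋z y~x → ~-sym (~-respʳ y≋z (~-sym y~x))
    ; ~-sym    = ~-sym
    ; ~-irrefl = λ x≋y (x≉y , _) → x≉y x≋y
    }

  module _ {q : ℕ} (order : HasOrder G q) where

    private module E = Inverse order

    Ω-enumeration : Enumeration Ω (q ℕ.^ m)
    Ω-enumeration = record
      { to        = λ k → E.to ∘ finToFun k
      ; from      = λ x → funToFin (E.from ∘ x)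
      ; to-cong   = λ { ≡.refl → ≋-refl }
      ; from-cong = λ x≋y → funToFin-cong (E.from-cong ∘ x≋y)
      ; inverse   =
            (λ { ≡.refl i → E.inverseˡ (finToFun-funToFin _ i) })
          , (λ {k} p → ≡.trans (funToFin-cong λ i → E.inverseʳ (p i))
                               (funToFin-finToFin {m} k))
      }

    private
      _≈?_ : Decidable _≈_
      _≈?_ = via-injection (Inverse⇒Injection (Symmetry.inverse order)) _≟_

      Q₀? : Decidable Q₀
      Q₀? x y = map′
        (λ (k , p) → E.to k , p)
        (λ (t , p) → E.from t , λ i →
          trans (p i) (∙-congʳ (sym (E.inverseˡ ≡.refl))))
        (any? λ k → all? λ i → y i ≈? (E.to k ∙ x i))

      Q? : ∀ i → Decidable (Q i)
      Q? i x y = all? λ j → ¬? (j ≟ i) →-dec (x j ≈? y j)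

    _~?_ : Decidable _~_
    x ~? y = ¬? (all? λ i → x i ≈? y i) ×-dec
             (Q₀? x y ⊎-dec any? λ i → Q? i x y)

module _ (F : HeytingField c ℓ₁ ℓ₂) (G : Group g ℓ) {q : ℕ}
         (order : HasOrder G q) (m : ℕ) where

  open Matrices F
  open Diagonal G m

  diagonalMatrix : SquareMatrix (q ℕ.^ m)
  diagonalMatrix =
    adjacencyMatrix diagonalGraph (_~?_ order) (Ω-enumeration order)

order-nonZero : (G : Group g ℓ) {q : ℕ} → HasOrder G q → NonZero q
order-nonZero G order = nonZeroIndex (Inverse.from order (Group.ε G))

-- (m+1 choose k) q⁻¹ (q−1) ((q−1)^(m−k) − (−1)^(m−k)), for k ≤ m
multiplicity : (m k q : ℕ) .{{_ : NonZero q}} → ℚ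
multiplicity m k q =
  (+ (suc m C k) * (+ q - 1ℤ) * ((+ q - 1ℤ) ^ (m ∸ k) - -1ℤ ^ (m ∸ k))) / q
  where open import Data.Integer.Base using (+_; 1ℤ; -1ℤ; _*_; _-_; _^_)
        open import Data.Nat.Base using (_∸_)

module Submission where

open import Defs
open import Algebra.Apartness.Bundles using (HeytingCommutativeRing; HeytingField)
import Algebra.Apartness.Properties.HeytingCommutativeRing
open import Algebra.Bundles using (CommutativeRing; Group)
import Algebra.Properties.AbelianGroup
import Algebra.Properties.CommutativeMonoid.Sum
import Algebra.Properties.Group
import Algebra.Properties.Ring
import Algebra.Properties.Semiring.Mult
import Algebra.Properties.Semiring.Sum
import Algebra.Solver.Ring
open import Algebra.Solver.Ring.AlmostCommutativeRing using (_-Raw-AlmostCommutative⟶_; fromCommutativeRing)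
open import Data.Bool.Base using (if_then_else_)
open import Data.Empty using (⊥-elim)
open import Data.Fin.Base as Fin using (Fin; zero; suc; combine; finToFun; fromℕ<; funToFin; punchIn; punchOut; toℕ)
open import Data.Fin.Permutation using (Permutation′; permutation)
open import Data.Fin.Properties as Fin
  using (¬Fin0; finToFun-funToFin; funToFin-finToFin; punchInᵢ≢i; punchIn-punchOut; toℕ<n; toℕ-fromℕ<; toℕ-injective; ¬∀⟶∃¬)
open import Data.Fin.Subset using (Subset; inside; outside; ∣_∣)
open import Data.Fin.Subset.Properties using (∣p∣≤n)
open import Data.Integer.Base as ℤ using (ℤ; +_; -[1+_]; -1ℤ; 1ℤ; _⊖_)
import Data.Integer.Properties as ℤ
import Data.Integer.Solver as ℤ
open import Data.Maybe.Base as Maybe using (Maybe)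
open import Data.Nat.Base as ℕ using (ℕ; zero; suc; _∸_; _^_; _≤_; _<_; s≤s; s≤s⁻¹; z≤n)
open import Data.Nat.Combinatorics using (_C_; nCk+nC[k+1]≡[n+1]C[k+1]; nCk≡nC[n∸k]; nCn≡1)
import Data.Nat.Properties as ℕ
import Data.Nat.Solver as ℕ
open import Data.Product.Base using (∃-syntax; _×_; _,_; proj₁; proj₂)
open import Data.Rational.Base as ℚ using (0ℚ; _/_; toℚᵘ)
import Data.Rational.Properties as ℚ
import Data.Rational.Unnormalised.Base as ℚᵘ
import Data.Rational.Unnormalised.Properties as ℚᵘ
open import Data.Sum.Base using (_⊎_; inj₁; inj₂)
open import Data.Vec.Base using ([]; _∷_; lookup)
open import Data.Vec.Functional using (Vector; updateAt) renaming (_∷_ to _∷ᶠ_)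
open import Data.Vec.Functional.Properties using (updateAt-minimal; updateAt-updates)
import Data.Vec.Functional.Relation.Binary.Equality.Setoid as VecEq
open import Function.Base using (_∘_; const; id)
open import Function.Bundles using (Inverse; _⇔_; mk⇔)
open import Function.Definitions using (Injective)
open import Level using (_⊔_)
open import Relation.Binary.Definitions using (tri<; tri≈; tri>)
open import Relation.Binary.PropositionalEquality.Core using (_≡_; _≢_; _≗_)
import Relation.Binary.PropositionalEquality as ≡
import Relation.Binary.Reasoning.Setoid as SetoidReasoning
open import Relation.Nullary.Decidable using (does; yes; no; dec-true; dec-false; dec⇒maybe)
open import Relation.Nullary.Negation using (¬_)

-- For each of the partitions Q₀, …, Q_m let Eᵢ average a function on Ω over the parts of Qᵢ.
-- The Eᵢ are commuting idempotents, and parts of different partitions meet in at most one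
-- point because m ≥ 2, so that A = q ∑ Eᵢ − (m + 1).  Hence the eigenvalues of A are
-- −(m + 1) + k q, with eigenprojection the coefficient of zᵏ in ∏ ((1 − Eᵢ) + z Eᵢ).
-- A product of j of the Eᵢ has trace q^(m − j) for j ≤ m and 1 for j = m + 1; these traces
-- determine those of the eigenprojections, and the rank of an idempotent matrix in
-- characteristic zero is its trace.

-- In a Heyting field it cannot be decided whether an element is 0, so neither elimination nor a
-- comparison of a value with a list of eigenvalues is available. Bases are built from pivots
-- instead: a sum that is apart from 0 has a summand apart from 0, and characteristic zero supplies
-- such sums as traces that are positive integers. An unknown eigenvalue is located by discarding
-- candidates through cotransitivity, and tightness turns the last one into an equality. The
-- multiplicity has its shape because the traces form a geometric sequence up to j = m and then
-- repeat the value 1. Had the last trace been 1/q, iterated differences would give (q - 1)^(m + 1 -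
-- k)/q; the excess 1 - 1/q = (q - 1)/q enters with the sign (-1)^(m + 1 - k), and the sum of the
-- two is the stated formula up to the binomial coefficient. It is 0 at k = m, so -(m + 1) + m q is
-- no eigenvalue, while k = m + 1 gives (m + 1)(q - 1).

-- The ring solver with integer coefficients, so that cancellation is recognised
-- although equality in the ring itself is not decidable.
module IntegerCoefficients {c ℓ} (R : CommutativeRing c ℓ) where
  open CommutativeRing R
  open Algebra.Properties.Ring ring
  open Algebra.Properties.AbelianGroup +-abelianGroup using (⁻¹-∙-comm)
  open Algebra.Properties.Semiring.Mult semiring using (×-homo-+; ×1-homo-*) renaming (_×_ to _·ℕ_)
  open SetoidReasoning setoid

  ⟪_⟫ : ℤ → Carrier
  ⟪ + n ⟫      = n ·ℕ 1#
  ⟪ -[1+ n ] ⟫ = - (suc n ·ℕ 1#)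

  private
    [x+y]-[x+z] : ∀ x y z → (x + y) - (x + z) ≈ y - z
    [x+y]-[x+z] x y z = begin
      (x + y) - (x + z)     ≈⟨ +-cong (+-comm x y) (sym (⁻¹-∙-comm x z)) ⟩
      (y + x) + (- x - z)   ≈⟨ +-assoc y x _ ⟩
      y + (x + (- x - z))   ≈⟨ +-congˡ (+-assoc x (- x) (- z)) ⟨
      y + ((x - x) - z)     ≈⟨ +-congˡ (+-congʳ (-‿inverseʳ x)) ⟩
      y + (0# - z)          ≈⟨ +-congˡ (+-identityˡ _) ⟩
      y - z                 ∎

    ⊖-homo : ∀ m n → ⟪ m ⊖ n ⟫ ≈ m ·ℕ 1# - n ·ℕ 1#
    ⊖-homo m zero = sym (trans (+-congˡ -0#≈0#) (+-identityʳ _))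
    ⊖-homo zero (suc n) = sym (+-identityˡ _)
    ⊖-homo (suc m) (suc n) = begin
      ⟪ suc m ⊖ suc n ⟫            ≡⟨ ≡.cong ⟪_⟫ (ℤ.[1+m]⊖[1+n]≡m⊖n m n) ⟩
      ⟪ m ⊖ n ⟫                    ≈⟨ ⊖-homo m n ⟩
      m ·ℕ 1# - n ·ℕ 1#              ≈⟨ [x+y]-[x+z] 1# _ _ ⟨
      suc m ·ℕ 1# - suc n ·ℕ 1#      ∎

    +-homo : ∀ i j → ⟪ i ℤ.+ j ⟫ ≈ ⟪ i ⟫ + ⟪ j ⟫
    +-homo (+ m) (+ n) = ×-homo-+ 1# m n
    +-homo (+ m) -[1+ n ] = ⊖-homo m (suc n)
    +-homo -[1+ m ] (+ n) = trans (⊖-homo n (suc m)) (+-comm _ _)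
    +-homo -[1+ m ] -[1+ n ] = begin
      - ((2 ℕ.+ (m ℕ.+ n)) ·ℕ 1#)      ≡⟨ ≡.cong (λ k → - (suc k ·ℕ 1#)) (ℕ.+-suc m n) ⟨
      - ((suc m ℕ.+ suc n) ·ℕ 1#)      ≈⟨ -‿cong (×-homo-+ 1# (suc m) (suc n)) ⟩
      - (suc m ·ℕ 1# + suc n ·ℕ 1#)     ≈⟨ ⁻¹-∙-comm _ _ ⟨
      - (suc m ·ℕ 1#) - (suc n ·ℕ 1#)   ∎

    -‿homo : ∀ i → ⟪ ℤ.- i ⟫ ≈ - ⟪ i ⟫
    -‿homo (+ zero) = sym -0#≈0#
    -‿homo (+ suc n) = refl
    -‿homo -[1+ n ] = sym (-‿involutive _)

    *-homo⁺ : ∀ m j → ⟪ + m ℤ.* j ⟫ ≈ m ·ℕ 1# * ⟪ j ⟫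
    *-homo⁺ m (+ n) = begin
      ⟪ + m ℤ.* + n ⟫      ≡⟨ ≡.cong ⟪_⟫ (ℤ.pos-* m n) ⟨
      (m ℕ.* n) ·ℕ 1#       ≈⟨ ×1-homo-* m n ⟩
      m ·ℕ 1# * (n ·ℕ 1#)    ∎
    *-homo⁺ m -[1+ n ] = begin
      ⟪ + m ℤ.* -[1+ n ] ⟫           ≡⟨ ≡.cong ⟪_⟫ (ℤ.neg-distribʳ-* (+ m) (+ suc n)) ⟨
      ⟪ ℤ.- (+ m ℤ.* + suc n) ⟫      ≈⟨ -‿homo (+ m ℤ.* + suc n) ⟩
      - ⟪ + m ℤ.* + suc n ⟫          ≈⟨ -‿cong (*-homo⁺ m (+ suc n)) ⟩
      - (m ·ℕ 1# * (suc n ·ℕ 1#))      ≈⟨ -‿distribʳ-* _ _ ⟩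
      m ·ℕ 1# * - (suc n ·ℕ 1#)        ∎

    *-homo : ∀ i j → ⟪ i ℤ.* j ⟫ ≈ ⟪ i ⟫ * ⟪ j ⟫
    *-homo (+ m) j = *-homo⁺ m j
    *-homo -[1+ m ] j = begin
      ⟪ -[1+ m ] ℤ.* j ⟫          ≡⟨ ≡.cong ⟪_⟫ (ℤ.neg-distribˡ-* (+ suc m) j) ⟨
      ⟪ ℤ.- (+ suc m ℤ.* j) ⟫     ≈⟨ -‿homo (+ suc m ℤ.* j) ⟩
      - ⟪ + suc m ℤ.* j ⟫         ≈⟨ -‿cong (*-homo⁺ (suc m) j) ⟩
      - (suc m ·ℕ 1# * ⟪ j ⟫)      ≈⟨ -‿distribˡ-* _ _ ⟩
      - (suc m ·ℕ 1#) * ⟪ j ⟫      ∎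

    homomorphism : ℤ.+-*-rawRing -Raw-AlmostCommutative⟶ fromCommutativeRing R
    homomorphism = record
      { ⟦_⟧    = ⟪_⟫
      ; +-homo = +-homo
      ; *-homo = *-homo
      ; -‿homo = -‿homo
      ; 0-homo = refl
      ; 1-homo = +-identityʳ 1#
      }

    _≟?_ : ∀ i j → Maybe (⟪ i ⟫ ≈ ⟪ j ⟫)
    i ≟? j = Maybe.map (λ i≡j → reflexive (≡.cong ⟪_⟫ i≡j)) (dec⇒maybe (i ℤ.≟ j))

  open Algebra.Solver.Ring ℤ.+-*-rawRing (fromCommutativeRing R) homomorphism _≟?_ public
    using (solve; _:=_; _:+_; _:*_; _:-_; :-_; con)

-- Heyting fields: apartness, finite sums and matrices.

module FieldProperties {c ℓ₁ ℓ₂} (F : HeytingField c ℓ₁ ℓ₂) where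
  open HeytingField F public hiding (zero)
  open HeytingCommutativeRing heytingCommutativeRing public using (commutativeRing)
  open CommutativeRing commutativeRing public using (ring; semiring; +-commutativeMonoid)
  open Matrices F public
  open VecEq setoid public using (_≋_)
  open Algebra.Apartness.Properties.HeytingCommutativeRing heytingCommutativeRing public
    using (#-congʳ; invertibleˡ⇒#; 1#0; x-0≈x)
  open Algebra.Properties.Ring ring public using (-‿distribˡ-*; x+x≈x⇒x≈0)
  open Algebra.Properties.Semiring.Mult semiring public using (×-homo-+; ×1-homo-*)
  open Algebra.Properties.Semiring.Sum semiring public
    using (sum; sum-cong-≋; sum-cong-≗; sum-replicate; sum-replicate-zero; *-distribˡ-sum; *-distribʳ-sum)
  open Algebra.Properties.CommutativeMonoid.Sum +-commutativeMonoid public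
    using (sum-remove; ∑-distrib-+; ∑-comm; sum-permute)
  open IntegerCoefficients commutativeRing public
  open SetoidReasoning setoid public

  #0⇒inverse : ∀ {x} → x # 0# → ∃[ x⁻¹ ] x⁻¹ * x ≈ 1#
  #0⇒inverse x#0 with x⁻¹ , p , _ ← #⇒invertible x#0 =
    x⁻¹ , trans (*-congˡ (sym (x-0≈x _))) p

  *-cancelˡ-#0 : ∀ {x y z} → x # 0# → x * y ≈ x * z → y ≈ z
  *-cancelˡ-#0 {x} {y} {z} x#0 xy≈xz with x⁻¹ , p ← #0⇒inverse x#0 = begin
    y               ≈⟨ *-identityˡ y ⟨
    1# * y          ≈⟨ *-congʳ p ⟨
    x⁻¹ * x * y     ≈⟨ *-assoc _ _ _ ⟩
    x⁻¹ * (x * y)   ≈⟨ *-congˡ xy≈xz ⟩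
    x⁻¹ * (x * z)   ≈⟨ *-assoc _ _ _ ⟨
    x⁻¹ * x * z     ≈⟨ *-congʳ p ⟩
    1# * z          ≈⟨ *-identityˡ z ⟩
    z               ∎

  x*y≈0⇒y≈0 : ∀ {x y} → x # 0# → x * y ≈ 0# → y ≈ 0#
  x*y≈0⇒y≈0 x#0 p = *-cancelˡ-#0 x#0 (trans p (sym (zeroʳ _)))

  #⇒-#0 : ∀ {x y} → x # y → x - y # 0#
  #⇒-#0 x#y with z , p , _ ← #⇒invertible x#y =
    invertibleˡ⇒# (z , trans (*-congˡ (x-0≈x _)) p)

  -#0⇒# : ∀ {x y} → x - y # 0# → x # y
  -#0⇒# x-y#0 = invertibleˡ⇒# (#0⇒inverse x-y#0)

  -- Cotransitivity compares `x + y` and `0#` with `y`; if `x + y` is apart from `y`, their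
  -- difference `x` is invertible.
  +#0⇒#0⊎#0 : ∀ {x y} → x + y # 0# → x # 0# ⊎ y # 0#
  +#0⇒#0⊎#0 {x} {y} x+y#0 with #-cotrans x+y#0 y
  ... | inj₁ x+y#y = inj₁ (#-congʳ (solve 2 (λ x y → x :+ y :- y := x) refl x y) (#⇒-#0 x+y#y))
  ... | inj₂ y#0 = inj₂ y#0

  -- This is the pivot search: no entry can be tested for being 0, but a sum known to be invertible
  -- yields an invertible summand.
  sum#0⇒#0 : ∀ {n} (t : Vector Carrier n) → sum t # 0# → ∃[ i ] t i # 0#
  sum#0⇒#0 {zero} t p = ⊥-elim (#-irrefl refl p)
  sum#0⇒#0 {suc n} t p with +#0⇒#0⊎#0 p
  ... | inj₁ q = zero , q
  ... | inj₂ q with i , r ← sum#0⇒#0 (λ i → t (suc i)) q = suc i , r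

  sum-zero : ∀ {n} {t : Vector Carrier n} → t ≋ 𝟎 → sum t ≈ 0#
  sum-zero {n} t≋𝟎 = trans (sum-cong-≋ t≋𝟎) (sum-replicate-zero n)

  sum-+* : ∀ {n} (x : Carrier) (f g : Vector Carrier n) →
           sum (λ i → f i + x * g i) ≈ sum f + x * sum g
  sum-+* x f g = trans (∑-distrib-+ f _) (+-congˡ (sym (*-distribˡ-sum x g)))

  sum-- : ∀ {n} (f g : Vector Carrier n) → sum (λ i → f i - g i) ≈ sum f - sum g
  sum-- {n} f g = begin
    sum (λ i → f i - g i)            ≈⟨ sum-cong-≋ {n} (λ i → rewrite-- (f i) (g i)) ⟩
    sum (λ i → f i + - 1# * g i)     ≈⟨ sum-+* {n} (- 1#) f g ⟩
    sum f + - 1# * sum g             ≈⟨ rewrite-- (sum f) (sum g) ⟨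
    sum f - sum g                    ∎
    where
    rewrite-- : ∀ x y → x - y ≈ x + - 1# * y
    rewrite-- x y = +-congˡ (trans (sym (-‿cong (*-identityˡ y))) (-‿distribˡ-* 1# y))

  sum-1 : ∀ n → sum {n} (λ _ → 1#) ≈ ⟦ n ⟧
  sum-1 n = sum-replicate n

  sum-const : ∀ n x → sum {n} (λ _ → x) ≈ ⟦ n ⟧ * x
  sum-const n x = begin
    sum {n} (λ _ → x)          ≈⟨ sum-cong-≋ {n} (λ _ → sym (*-identityˡ x)) ⟩
    sum {n} (λ _ → 1# * x)     ≈⟨ *-distribʳ-sum {n} x (λ _ → 1#) ⟨
    sum {n} (λ _ → 1#) * x     ≈⟨ *-congʳ (sum-1 n) ⟩
    ⟦ n ⟧ * x                  ∎

  *ᵥ-cong : ∀ {n} (e : SquareMatrix n) {v w} → v ≋ w → e *ᵥ v ≋ e *ᵥ w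
  *ᵥ-cong e v≋w i = sum-cong-≋ (λ j → *-congˡ (v≋w j))

  *ᵥ-+· : ∀ {n} (e : SquareMatrix n) x v w →
          e *ᵥ (λ j → v j + x * w j) ≋ (λ i → (e *ᵥ v) i + x * (e *ᵥ w) i)
  *ᵥ-+· {n} e x v w i = trans
    (sum-cong-≋ (λ j → solve 4 (λ a v x w → a :* (v :+ x :* w) := a :* v :+ x :* (a :* w))
                         refl (e i j) (v j) x (w j)))
    (sum-+* {n} x _ _)

  trace : ∀ {n} → SquareMatrix n → Carrier
  trace e = sum λ i → e i i

  Idempotent : ∀ {n} → SquareMatrix n → Set ℓ₁
  Idempotent e = ∀ i k → sum (λ j → e i j * e j k) ≈ e i k

  Fixed : ∀ {n} → SquareMatrix n → Vector Carrier n → Set ℓ₁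
  Fixed e v = e *ᵥ v ≋ v

  idempotent⇒fixed : ∀ {n} {e : SquareMatrix n} → Idempotent e → ∀ v → Fixed e (e *ᵥ v)
  idempotent⇒fixed {n} {e} idem v i = begin
    sum (λ j → e i j * sum (λ k → e j k * v k))
      ≈⟨ sum-cong-≋ (λ j → *-distribˡ-sum {n} (e i j) _) ⟩
    sum (λ j → sum (λ k → e i j * (e j k * v k)))
      ≈⟨ ∑-comm (λ j k → e i j * (e j k * v k)) ⟩
    sum (λ k → sum (λ j → e i j * (e j k * v k)))
      ≈⟨ sum-cong-≋ (λ k → sum-cong-≋ (λ j → sym (*-assoc (e i j) (e j k) (v k)))) ⟩
    sum (λ k → sum (λ j → e i j * e j k * v k))
      ≈⟨ sum-cong-≋ (λ k → *-distribʳ-sum {n} (v k) _) ⟨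
    sum (λ k → sum (λ j → e i j * e j k) * v k)
      ≈⟨ sum-cong-≋ (λ k → *-congʳ (idem i k)) ⟩
    sum (λ k → e i k * v k)                         ∎

-- The rank of an idempotent matrix is its trace.

module IdempotentRank {c ℓ₁ ℓ₂} (F : HeytingField c ℓ₁ ℓ₂)
                      (char0 : Matrices.CharacteristicZero F) where
  open FieldProperties F

  -- With 1 − eᵢᵢ invertible, the kernel of e contains a vector with i-th coordinate 1;
  -- projecting along it onto the hyperplane vᵢ = 0 turns e into an idempotent of
  -- smaller size and the same trace.
  private
    module Compression {n} (e : SquareMatrix (suc n)) (idem : Idempotent e)
             (i : Fin (suc n)) (s : Carrier) (s[1-x] : s * (1# - e i i) ≈ 1#) where

      x = e i i

      -- With `s` the inverse of `1# - x`, this is 1 minus the Schur complement of the pivot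
      -- `1# - x` in 1 - e.
      compression : SquareMatrix n
      compression a b = e (punchIn i a) (punchIn i b) + s * (e (punchIn i a) i * e i (punchIn i b))

      -- The ring solver cannot use that `s` is an inverse, so the identities below are arranged to
      -- need this only through factors `s - s * x`.
      s-s*x : s - s * x ≈ 1#
      s-s*x = begin
        s - s * x           ≈⟨ +-congʳ (*-identityʳ s) ⟨
        s * 1# - s * x      ≈⟨ solve 3 (λ s o x → s :* (o :- x) := s :* o :- s :* x) refl s 1# x ⟨
        s * (1# - x)        ≈⟨ s[1-x] ⟩
        1#                  ∎

      -- Products of blocks of `e` all reduce to this: the equation e e = e with the i-th summand
      -- moved to the other side.
      punched : ∀ a d → sum (λ b → e a (punchIn i b) * e (punchIn i b) d) ≈ e a d - e a i * e i d
      punched a d = begin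
        r                             ≈⟨ solve 2 (λ r t → r := t :+ r :- t) refl r t ⟩
        t + r - t                     ≈⟨ +-congʳ (sum-remove {i = i} (λ b → e a b * e b d)) ⟨
        sum (λ b → e a b * e b d) - t ≈⟨ +-congʳ (idem a d) ⟩
        e a d - t                     ∎
        where
        r = sum (λ b → e a (punchIn i b) * e (punchIn i b) d)
        t = e a i * e i d

      -- The correction terms add up to s (x - x²) = x, which is the diagonal entry lost with row
      -- and column i.
      compression-trace : trace compression ≈ trace e
      compression-trace = begin
        sum (λ a → e (p a) (p a) + s * (e (p a) i * e i (p a)))
          ≈⟨ sum-cong-≋ (λ a → +-congˡ (*-congˡ (*-comm (e (p a) i) (e i (p a))))) ⟩
        sum (λ a → e (p a) (p a) + s * (e i (p a) * e (p a) i))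
          ≈⟨ sum-+* {n} s _ _ ⟩
        r + s * sum (λ a → e i (p a) * e (p a) i)
          ≈⟨ +-congˡ (*-congˡ (punched i i)) ⟩
        r + s * (x - x * x)
          ≈⟨ solve 3 (λ r s x → r :+ s :* (x :- x :* x) := r :+ (s :- s :* x) :* x) refl r s x ⟩
        r + (s - s * x) * x
          ≈⟨ +-congˡ (*-congʳ s-s*x) ⟩
        r + 1# * x
          ≈⟨ +-congˡ (*-identityˡ x) ⟩
        r + x
          ≈⟨ +-comm r x ⟩
        x + r
          ≈⟨ sum-remove {i = i} (λ a → e a a) ⟨
        trace e ∎
        where
        p = punchIn i
        r = sum (λ a → e (p a) (p a))

      compression-idempotent : Idempotent compression
      compression-idempotent a′ d′ = begin
        sum (λ b → (e a (p b) + s * (u * e i (p b))) * (e (p b) d + s * (e (p b) i * w)))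
          ≈⟨ sum-cong-≋ (λ b → solve 7
               (λ A s u B C D w → (A :+ s :* (u :* B)) :* (C :+ s :* (D :* w)) :=
                 A :* C :+ (s :* w) :* (A :* D) :+ (s :* u) :* (B :* C) :+ (s :* u :* (s :* w)) :* (B :* D))
               refl (e a (p b)) s u (e i (p b)) (e (p b) d) (e (p b) i) w) ⟩
        sum (λ b → e a (p b) * e (p b) d + s * w * (e a (p b) * e (p b) i)
                   + s * u * (e i (p b) * e (p b) d) + s * u * (s * w) * (e i (p b) * e (p b) i))
          ≈⟨ trans (sum-+* {n} _ _ _) (+-congʳ (trans (sum-+* {n} _ _ _) (+-congʳ (sum-+* {n} _ _ _)))) ⟩
        sum (λ b → e a (p b) * e (p b) d) + s * w * sum (λ b → e a (p b) * e (p b) i)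
          + s * u * sum (λ b → e i (p b) * e (p b) d) + s * u * (s * w) * sum (λ b → e i (p b) * e (p b) i)
          ≈⟨ +-cong (+-cong (+-cong (punched a d) (*-congˡ (punched a i))) (*-congˡ (punched i d)))
                    (*-congˡ (punched i i)) ⟩
        e a d - u * w + s * w * (u - u * x) + s * u * (w - x * w) + s * u * (s * w) * (x - x * x)
          ≈⟨ solve 5 (λ A u w s x →
               A :- u :* w :+ s :* w :* (u :- u :* x) :+ s :* u :* (w :- x :* w)
                 :+ s :* u :* (s :* w) :* (x :- x :* x)
               := A :- u :* w :+ (s :- s :* x) :* (u :* w) :+ (s :- s :* x) :* (u :* w)
                 :+ (s :- s :* x) :* (s :* x :* (u :* w)))
               refl (e a d) u w s x ⟩
        e a d - u * w + (s - s * x) * (u * w) + (s - s * x) * (u * w) + (s - s * x) * (s * x * (u * w))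
          ≈⟨ +-cong (+-cong (+-congˡ (1· _)) (1· _)) (1· _) ⟩
        e a d - u * w + u * w + u * w + s * x * (u * w)
          -- One copy of `u * w` goes back to `(s - s * x) * (u * w)`, which together with
          -- `s * x * (u * w)` makes `s * (u * w)`.
          ≈⟨ +-congʳ (+-congˡ (sym (1· _))) ⟩
        e a d - u * w + u * w + (s - s * x) * (u * w) + s * x * (u * w)
          ≈⟨ solve 5 (λ A u w s x → A :- u :* w :+ u :* w :+ (s :- s :* x) :* (u :* w) :+ s :* x :* (u :* w)
               := A :+ s :* (u :* w)) refl (e a d) u w s x ⟩
        e a d + s * (u * w) ∎
        where
        p = punchIn i
        a = p a′
        d = p d′
        u = e a i
        w = e i d
        1· : ∀ y → (s - s * x) * y ≈ y
        1· y = trans (*-congʳ s-s*x) (*-identityˡ y)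

      module _ (vanishes : ∀ a b → compression a b ≈ 0#) where

        private
          -- Vanishing says e_ab = - s u e_ib. Substituted into `punched a i` this gives u - u x = -
          -- s u (x - x²) = - u x, hence u = 0.
          column : ∀ a → e (punchIn i a) i ≈ 0#
          column a′ = begin
            u
              ≈⟨ solve 3 (λ u x t → u := (u :- u :* x) :+ u :* x) refl u x x ⟩
            (u - u * x) + u * x
              ≈⟨ +-congʳ (punched a i) ⟨
            sum (λ b → e a (p b) * e (p b) i) + u * x
              ≈⟨ +-congʳ (sum-cong-≋ (λ b → solve 5 (λ A s u B C →
                   A :* C := (A :+ s :* (u :* B)) :* C :+ (:- (s :* u)) :* (B :* C))
                   refl (e a (p b)) s u (e i (p b)) (e (p b) i))) ⟩
            sum (λ b → (e a (p b) + s * (u * e i (p b))) * e (p b) i + - (s * u) * (e i (p b) * e (p b) i)) + u * x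
              ≈⟨ +-congʳ (sum-cong-≋ (λ b → +-congʳ (trans (*-congʳ (vanishes a′ b)) (zeroˡ _)))) ⟩
            sum (λ b → 0# + - (s * u) * (e i (p b) * e (p b) i)) + u * x
              ≈⟨ +-congʳ (trans (sum-+* {n} (- (s * u)) (λ _ → 0#) _)
                   (+-cong (sum-zero {n} (λ _ → refl)) (*-congˡ (punched i i)))) ⟩
            0# + - (s * u) * (x - x * x) + u * x
              ≈⟨ +-congʳ (+-identityˡ _) ⟩
            - (s * u) * (x - x * x) + u * x
              ≈⟨ solve 3 (λ s u x → (:- (s :* u)) :* (x :- x :* x) :+ u :* x
                   := u :* x :- (s :- s :* x) :* (u :* x)) refl s u x ⟩
            u * x - (s - s * x) * (u * x)
              ≈⟨ +-congˡ (-‿cong (trans (*-congʳ s-s*x) (*-identityˡ _))) ⟩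
            u * x - u * x
              ≈⟨ -‿inverseʳ _ ⟩
            0# ∎
            where
            p = punchIn i
            a = p a′
            u = e a i

          minor : ∀ a b → e (punchIn i a) (punchIn i b) ≈ 0#
          minor a b = begin
            A                    ≈⟨ solve 4 (λ A s u w → A := (A :+ s :* (u :* w)) :- s :* (u :* w)) refl A s u w ⟩
            compression a b - s * (u * w)
                                 ≈⟨ +-cong (vanishes a b) (-‿cong (*-congˡ (trans (*-congʳ (column a)) (zeroˡ w)))) ⟩
            0# - s * 0#          ≈⟨ +-congˡ (-‿cong (zeroʳ s)) ⟩
            0# - 0#              ≈⟨ -‿inverseʳ 0# ⟩
            0#                   ∎
            where
            A = e (punchIn i a) (punchIn i b)
            u = e (punchIn i a) i
            w = e i (punchIn i b)

          corner : x ≈ 0#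
          corner = begin
            x                      ≈⟨ *-identityˡ x ⟨
            1# * x                 ≈⟨ *-congʳ s-s*x ⟨
            (s - s * x) * x        ≈⟨ solve 2 (λ s x → (s :- s :* x) :* x := s :* (x :- x :* x)) refl s x ⟩
            s * (x - x * x)        ≈⟨ *-congˡ (punched i i) ⟨
            s * sum (λ b → e i (punchIn i b) * e (punchIn i b) i)
              ≈⟨ *-congˡ (sum-zero (λ b → trans (*-congˡ (column b)) (zeroʳ _))) ⟩
            s * 0#                 ≈⟨ zeroʳ s ⟩
            0#                     ∎

          row : ∀ b → e i (punchIn i b) ≈ 0#
          row b = begin
            w                          ≈⟨ solve 2 (λ w x → w := (w :- x :* w) :+ x :* w) refl w x ⟩
            (w - x * w) + x * w        ≈⟨ +-congʳ (punched i (punchIn i b)) ⟨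
            sum (λ a → e i (punchIn i a) * e (punchIn i a) (punchIn i b)) + x * w
              ≈⟨ +-cong (sum-zero (λ a → trans (*-congˡ (minor a b)) (zeroʳ _))) (*-congʳ corner) ⟩
            0# + 0# * w                ≈⟨ trans (+-identityˡ _) (zeroˡ w) ⟩
            0#                         ∎
            where w = e i (punchIn i b)

          decompose : ∀ j → j ≡ i ⊎ (∃[ a ] j ≡ punchIn i a)
          decompose j with i Fin.≟ j
          ... | yes i≡j = inj₁ (≡.sym i≡j)
          ... | no  i≢j = inj₂ (punchOut i≢j , ≡.sym (punchIn-punchOut i≢j))

        compression-vanishes⇒vanishes : ∀ a b → e a b ≈ 0#
        compression-vanishes⇒vanishes a b with decompose a | decompose b
        ... | inj₁ ≡.refl        | inj₁ ≡.refl        = corner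
        ... | inj₁ ≡.refl        | inj₂ (b′ , ≡.refl) = row b′
        ... | inj₂ (a′ , ≡.refl) | inj₁ ≡.refl        = column a′
        ... | inj₂ (a′ , ≡.refl) | inj₂ (b′ , ≡.refl) = minor a′ b′

  private
    cotrace : ∀ {n} (e : SquareMatrix n) → trace e ≈ 0# → sum (λ i → 1# - e i i) ≈ ⟦ n ⟧
    cotrace {n} e tr≈0 = begin
      sum (λ i → 1# - e i i)           ≈⟨ sum-- {n} (λ _ → 1#) _ ⟩
      sum {n} (λ _ → 1#) - trace e     ≈⟨ +-cong (sum-1 n) (-‿cong tr≈0) ⟩
      ⟦ n ⟧ - 0#                       ≈⟨ x-0≈x _ ⟩
      ⟦ n ⟧                            ∎

  -- The elements `1# - e i i` sum to the size of `e`, a positive integer, so one of them is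
  -- invertible. Compressing there keeps the trace and lowers the size.
  trace-zero⇒vanishes : ∀ {n} (e : SquareMatrix n) → Idempotent e → trace e ≈ 0# → ∀ a b → e a b ≈ 0#
  trace-zero⇒vanishes {zero} e idem tr≈0 ()
  trace-zero⇒vanishes {suc n} e idem tr≈0
    with i , 1-x#0 ← sum#0⇒#0 (λ i → 1# - e i i) (#-congʳ (sym (cotrace e tr≈0)) (char0 n))
    with s , s[1-x] ← #0⇒inverse 1-x#0
    = compression-vanishes⇒vanishes
        (trace-zero⇒vanishes compression compression-idempotent (trans compression-trace tr≈0))
    where open Compression e idem i s s[1-x]

  -- With eᵢᵢ invertible, the fixed vectors of e split as the multiples of column i and
  -- the fixed vectors whose i-th coordinate vanishes.
  private
    module Deflation {n} (e : SquareMatrix n) (idem : Idempotent e)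
             (i : Fin n) (s : Carrier) (sx : s * e i i ≈ 1#) where

      x = e i i

      column : Vector Carrier n
      column a = s * e a i

      -- The subtracted matrix is a rank-one idempotent, since row i times column i is `x` and
      -- `s * x` is 1; multiplying it by `e` on either side leaves it unchanged, so the difference
      -- is again idempotent.
      deflation : SquareMatrix n
      deflation a b = e a b - s * (e a i * e i b)

      column-fixed : Fixed e column
      column-fixed a = begin
        sum (λ b → e a b * (s * e b i))
          ≈⟨ sum-cong-≋ (λ b → solve 3 (λ A s B → A :* (s :* B) := s :* (A :* B)) refl (e a b) s (e b i)) ⟩
        sum (λ b → s * (e a b * e b i))     ≈⟨ *-distribˡ-sum {n} s _ ⟨
        s * sum (λ b → e a b * e b i)       ≈⟨ *-congˡ (idem a i) ⟩
        s * e a i                           ∎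

      deflation-*ᵥ : ∀ v → deflation *ᵥ v ≋ (λ a → (e *ᵥ v) a - (e *ᵥ v) i * column a)
      deflation-*ᵥ v a = begin
        sum (λ b → (e a b - s * (u * e i b)) * v b)
          ≈⟨ sum-cong-≋ (λ b → solve 5 (λ A s u B v →
               (A :- s :* (u :* B)) :* v := A :* v :+ (:- (s :* u)) :* (B :* v))
               refl (e a b) s u (e i b) (v b)) ⟩
        sum (λ b → e a b * v b + - (s * u) * (e i b * v b))   ≈⟨ sum-+* {n} _ _ _ ⟩
        (e *ᵥ v) a + - (s * u) * (e *ᵥ v) i
          ≈⟨ solve 4 (λ y s u z → y :+ (:- (s :* u)) :* z := y :- z :* (s :* u)) refl ((e *ᵥ v) a) s u ((e *ᵥ v) i) ⟩
        (e *ᵥ v) a - (e *ᵥ v) i * (s * u) ∎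
        where u = e a i

      deflation-trace : trace deflation ≈ trace e - 1#
      deflation-trace = begin
        sum (λ a → e a a - s * (e a i * e i a))       ≈⟨ sum-- (λ a → e a a) _ ⟩
        trace e - sum (λ a → s * (e a i * e i a))
          ≈⟨ +-congˡ (-‿cong (trans (sum-cong-≋ (λ a → *-congˡ (*-comm (e a i) (e i a)))) (sym (*-distribˡ-sum {n} s _)))) ⟩
        trace e - s * sum (λ a → e i a * e a i)       ≈⟨ +-congˡ (-‿cong (trans (*-congˡ (idem i i)) sx)) ⟩
        trace e - 1#                                  ∎

      deflation-idempotent : Idempotent deflation
      deflation-idempotent a d = begin
        sum (λ b → (e a b - s * (u * e i b)) * (e b d - s * (e b i * w)))
          ≈⟨ sum-cong-≋ (λ b → solve 7
               (λ A s u B C D w → (A :- s :* (u :* B)) :* (C :- s :* (D :* w)) :=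
                 A :* C :+ (:- (s :* w)) :* (A :* D) :+ (:- (s :* u)) :* (B :* C) :+ (s :* u :* (s :* w)) :* (B :* D))
               refl (e a b) s u (e i b) (e b d) (e b i) w) ⟩
        sum (λ b → e a b * e b d + - (s * w) * (e a b * e b i)
                   + - (s * u) * (e i b * e b d) + s * u * (s * w) * (e i b * e b i))
          ≈⟨ trans (sum-+* {n} _ _ _) (+-congʳ (trans (sum-+* {n} _ _ _) (+-congʳ (sum-+* {n} _ _ _)))) ⟩
        sum (λ b → e a b * e b d) + - (s * w) * sum (λ b → e a b * e b i)
          + - (s * u) * sum (λ b → e i b * e b d) + s * u * (s * w) * sum (λ b → e i b * e b i)
          ≈⟨ +-cong (+-cong (+-cong (idem a d) (*-congˡ (idem a i))) (*-congˡ (idem i d))) (*-congˡ (idem i i)) ⟩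
        e a d + - (s * w) * u + - (s * u) * w + s * u * (s * w) * x
          ≈⟨ solve 5 (λ A u w s x → A :+ (:- (s :* w)) :* u :+ (:- (s :* u)) :* w :+ s :* u :* (s :* w) :* x
               := A :- s :* (u :* w) :- s :* (u :* w) :+ (s :* x) :* (s :* (u :* w))) refl (e a d) u w s x ⟩
        e a d - s * (u * w) - s * (u * w) + (s * x) * (s * (u * w))
          ≈⟨ +-congˡ (trans (*-congʳ sx) (*-identityˡ _)) ⟩
        e a d - s * (u * w) - s * (u * w) + s * (u * w)
          ≈⟨ solve 2 (λ A t → A :- t :- t :+ t := A :- t) refl (e a d) (s * (u * w)) ⟩
        e a d - s * (u * w) ∎
        where
        u = e a i
        w = e i d

      -- Such a `v` is a combination of `e *ᵥ v` and `column`, both in the image of `e`.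
      deflation-fixed⇒fixed : ∀ {v} → Fixed deflation v → Fixed e v
      deflation-fixed⇒fixed {v} fix a = begin
        (e *ᵥ v) a                                      ≈⟨ *ᵥ-cong e v≋ a ⟩
        (e *ᵥ (λ b → ev b + (- ev i) * column b)) a     ≈⟨ *ᵥ-+· e (- ev i) ev column a ⟩
        (e *ᵥ ev) a + (- ev i) * (e *ᵥ column) a        ≈⟨ +-cong (idempotent⇒fixed idem v a) (*-congˡ (column-fixed a)) ⟩
        ev a + (- ev i) * column a                      ≈⟨ v≋ a ⟨
        v a                                             ∎
        where
        ev = e *ᵥ v
        v≋ : v ≋ (λ b → ev b + (- ev i) * column b)
        v≋ b = trans (sym (fix b)) (trans (deflation-*ᵥ v b)
          (solve 3 (λ y z t → y :- z :* t := y :+ (:- z) :* t) refl (ev b) (ev i) (column b)))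

      -- Row i of the deflation is zero, because the i-th coordinate of `column` is `s * x`, which
      -- is 1.
      deflation-fixed⇒coordinate : ∀ {v} → Fixed deflation v → v i ≈ 0#
      deflation-fixed⇒coordinate {v} fix = begin
        v i                                  ≈⟨ fix i ⟨
        (deflation *ᵥ v) i                   ≈⟨ deflation-*ᵥ v i ⟩
        (e *ᵥ v) i - (e *ᵥ v) i * (s * x)    ≈⟨ +-congˡ (-‿cong (trans (*-congˡ sx) (*-identityʳ _))) ⟩
        (e *ᵥ v) i - (e *ᵥ v) i              ≈⟨ -‿inverseʳ _ ⟩
        0#                                   ∎

      remainder-fixed : ∀ {v} → Fixed e v → Fixed deflation (λ a → v a - v i * column a)
      remainder-fixed {v} fix a = begin
        (deflation *ᵥ w) a                 ≈⟨ deflation-*ᵥ w a ⟩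
        (e *ᵥ w) a - (e *ᵥ w) i * column a ≈⟨ +-cong (ew a) (-‿cong (*-congʳ (trans (ew i) wi≈0))) ⟩
        w a - 0# * column a                ≈⟨ +-congˡ (-‿cong (zeroˡ _)) ⟩
        w a - 0#                           ≈⟨ x-0≈x _ ⟩
        w a                                ∎
        where
        w = λ a → v a - v i * column a
        ew : Fixed e w
        ew b = begin
          (e *ᵥ w) b
            ≈⟨ *ᵥ-cong e (λ b → solve 3 (λ y z t → y :- z :* t := y :+ (:- z) :* t) refl (v b) (v i) (column b)) b ⟩
          (e *ᵥ (λ b → v b + (- v i) * column b)) b     ≈⟨ *ᵥ-+· e (- v i) v column b ⟩
          (e *ᵥ v) b + (- v i) * (e *ᵥ column) b        ≈⟨ +-cong (fix b) (*-congˡ (column-fixed b)) ⟩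
          v b + (- v i) * column b
            ≈⟨ solve 3 (λ y z t → y :- z :* t := y :+ (:- z) :* t) refl (v b) (v i) (column b) ⟨
          v b - v i * column b                          ∎
        wi≈0 : w i ≈ 0#
        wi≈0 = trans (+-congˡ (-‿cong (trans (*-congˡ sx) (*-identityʳ _)))) (-‿inverseʳ _)

      extend : ∀ {d} → HasDimension (Fixed deflation) d → HasDimension (Fixed e) (suc d)
      extend {d} (b , b-fixed , indep , span) = column ∷ᶠ b , fixed′ , indep′ , span′
        where
        fixed′ : ∀ j → Fixed e ((column ∷ᶠ b) j)
        fixed′ zero = column-fixed
        fixed′ (suc j) = deflation-fixed⇒fixed (b-fixed j)

        indep′ : LinearlyIndependent (column ∷ᶠ b)
        indep′ y ∑≈0 = λ { zero → y₀≈0 ; (suc j) → indep (λ j → y (suc j)) tail≈0 j }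
          where
          -- In the i-th coordinate every `b j` vanishes and `column` has the value 1, so that
          -- coordinate reads off `y zero`.
          y₀≈0 : y zero ≈ 0#
          y₀≈0 = begin
            y zero                 ≈⟨ trans (*-congˡ sx) (*-identityʳ _) ⟨
            y zero * (s * x)       ≈⟨ +-identityʳ _ ⟨
            y zero * (s * x) + 0#
              ≈⟨ +-congˡ (sum-zero (λ j → trans (*-congˡ (deflation-fixed⇒coordinate (b-fixed j))) (zeroʳ _))) ⟨
            y zero * (s * x) + sum (λ j → y (suc j) * b j i)  ≈⟨ ∑≈0 i ⟩
            0#                     ∎
          tail≈0 : linearCombination (λ j → y (suc j)) b ≋ 𝟎
          tail≈0 a = begin
            sum (λ j → y (suc j) * b j a)       ≈⟨ +-identityˡ _ ⟨
            0# + sum (λ j → y (suc j) * b j a)  ≈⟨ +-congʳ (trans (*-congʳ y₀≈0) (zeroˡ _)) ⟨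
            y zero * column a + sum (λ j → y (suc j) * b j a)  ≈⟨ ∑≈0 a ⟩
            0#                                  ∎

        span′ : ∀ v → Fixed e v → ∃[ y ] v ≋ linearCombination y (column ∷ᶠ b)
        span′ v fix = v i ∷ᶠ proj₁ rest , λ a → begin
          v a                                       ≈⟨ solve 2 (λ v t → v := t :+ (v :- t)) refl (v a) (v i * column a) ⟩
          v i * column a + (v a - v i * column a)   ≈⟨ +-congˡ (proj₂ rest a) ⟩
          v i * column a + linearCombination (proj₁ rest) b a ∎
          where rest = span _ (remainder-fixed fix)

  -- While the trace is a positive integer some diagonal entry is invertible, and deflating there
  -- splits off one basis vector; at trace 0 nothing is left to be spanned.
  dimension-fixed : ∀ {n} d (e : SquareMatrix n) → Idempotent e → trace e ≈ ⟦ d ⟧ → HasDimension (Fixed e) d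
  dimension-fixed zero e idem tr = (λ ()) , (λ ()) , (λ _ _ ()) , λ v fix → (λ ()) , λ a →
    trans (sym (fix a)) (sum-zero (λ b → trans (*-congʳ (trace-zero⇒vanishes e idem tr a b)) (zeroˡ _)))
  dimension-fixed (suc d) e idem tr
    with i , x#0 ← sum#0⇒#0 (λ i → e i i) (#-congʳ (sym tr) (char0 d))
    with s , sx ← #0⇒inverse x#0
    = extend (dimension-fixed d deflation deflation-idempotent deflated-trace)
    where
    open Deflation e idem i s sx
    deflated-trace : trace deflation ≈ ⟦ d ⟧
    deflated-trace = begin
      trace deflation     ≈⟨ deflation-trace ⟩
      trace e - 1#        ≈⟨ +-congʳ tr ⟩
      1# + ⟦ d ⟧ - 1#     ≈⟨ solve 2 (λ o d → o :+ d :- o := d) refl 1# ⟦ d ⟧ ⟩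
      ⟦ d ⟧               ∎

-- Linear operators on vectors and their traces.

module LinearOperators {c ℓ₁ ℓ₂} (F : HeytingField c ℓ₁ ℓ₂) where
  open FieldProperties F

  -- Functions rather than matrices, so that a product is a composition and averaging is a sum of
  -- reindexings; `matrix` returns to matrices where the rank is needed.
  Operator : ℕ → Set c
  Operator n = Vector Carrier n → Vector Carrier n

  record Linear {n} (L : Operator n) : Set (c ⊔ ℓ₁) where
    field
      congruent : ∀ {v w} → v ≋ w → L v ≋ L w
      linear    : ∀ x v w → L (λ i → v i + x * w i) ≋ (λ i → L v i + x * L w i)

    zero-homo : L 𝟎 ≋ 𝟎
    zero-homo i = x+x≈x⇒x≈0 _ (sym (begin
      L 𝟎 i                       ≈⟨ congruent (λ _ → trans (sym (+-identityˡ 0#)) (+-congˡ (sym (zeroʳ 1#)))) i ⟩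
      L (λ _ → 0# + 1# * 0#) i    ≈⟨ linear 1# 𝟎 𝟎 i ⟩
      L 𝟎 i + 1# * L 𝟎 i          ≈⟨ +-congˡ (*-identityˡ _) ⟩
      L 𝟎 i + L 𝟎 i               ∎))

    vanishing : ∀ {v} → v ≋ 𝟎 → L v ≋ 𝟎
    vanishing v≋𝟎 i = trans (congruent v≋𝟎 i) (zero-homo i)

    +-homo : ∀ v w → L (λ i → v i + w i) ≋ (λ i → L v i + L w i)
    +-homo v w i = begin
      L (λ j → v j + w j) i         ≈⟨ congruent (λ j → +-congˡ (sym (*-identityˡ (w j)))) i ⟩
      L (λ j → v j + 1# * w j) i    ≈⟨ linear 1# v w i ⟩
      L v i + 1# * L w i            ≈⟨ +-congˡ (*-identityˡ _) ⟩
      L v i + L w i                 ∎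

    ·-homo : ∀ x v → L (x · v) ≋ x · L v
    ·-homo x v i = begin
      L (x · v) i                   ≈⟨ congruent (λ j → sym (+-identityˡ _)) i ⟩
      L (λ j → 0# + x * v j) i      ≈⟨ linear x 𝟎 v i ⟩
      L 𝟎 i + x * L v i             ≈⟨ +-congʳ (zero-homo i) ⟩
      0# + x * L v i                ≈⟨ +-identityˡ _ ⟩
      x * L v i                     ∎

    -‿homo : ∀ v → L (λ i → - v i) ≋ (λ i → - L v i)
    -‿homo v i = begin
      L (λ j → - v j) i         ≈⟨ congruent (λ j → trans (sym (*-identityˡ _)) (-1*v j)) i ⟩
      L ((- 1#) · v) i          ≈⟨ ·-homo (- 1#) v i ⟩
      - 1# * L v i              ≈⟨ solve 2 (λ o x → (:- o) :* x := :- (o :* x)) refl 1# (L v i) ⟩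
      - (1# * L v i)            ≈⟨ -‿cong (*-identityˡ _) ⟩
      - L v i                   ∎
      where
      -1*v : ∀ j → 1# * - v j ≈ - 1# * v j
      -1*v j = solve 2 (λ o x → o :* (:- x) := (:- o) :* x) refl 1# (v j)

    sum-homo : ∀ {d} (vs : Vector (Vector Carrier n) d) →
               L (λ i → sum λ j → vs j i) ≋ (λ i → sum λ j → L (vs j) i)
    sum-homo {zero} vs = zero-homo
    sum-homo {suc d} vs i = trans (+-homo (vs zero) (λ i → sum λ j → vs (suc j) i) i) (+-congˡ (sum-homo (vs ∘ suc) i))

    -+-homo : ∀ u v w → L (λ i → u i - v i + w i) ≋ (λ i → L u i - L v i + L w i)
    -+-homo u v w i = trans (+-homo _ w i) (+-congʳ (trans (+-homo u _ i) (+-congˡ (-‿homo v i))))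

  open Linear public

  id-linear : ∀ {n} → Linear {n} id
  id-linear = record { congruent = id ; linear = λ _ _ _ _ → refl }

  𝟎-linear : ∀ {n} → Linear {n} (λ _ → 𝟎)
  𝟎-linear = record
    { congruent = λ _ _ → refl
    ; linear = λ x _ _ _ → sym (trans (+-congˡ (zeroʳ x)) (+-identityʳ 0#)) }

  ∘-linear : ∀ {n} {K L : Operator n} → Linear K → Linear L → Linear (K ∘ L)
  ∘-linear K-lin L-lin = record
    { congruent = congruent K-lin ∘ congruent L-lin
    ; linear = λ x v w i → trans (congruent K-lin (linear L-lin x v w) i) (linear K-lin x _ _ i) }

  sum-linear : ∀ {n d} {L : Fin d → Operator n} → (∀ j → Linear (L j)) → Linear (λ v i → sum λ j → L j v i)
  sum-linear {n} {d} lin = record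
    { congruent = λ v≋w i → sum-cong-≋ {d} (λ j → congruent (lin j) v≋w i)
    ; linear = λ x v w i → trans (sum-cong-≋ {d} (λ j → linear (lin j) x v w i)) (sum-+* {d} x _ _) }

  ·-linear : ∀ {n} {L : Operator n} x → Linear L → Linear (λ v → x · L v)
  ·-linear x lin = record
    { congruent = λ v≋w i → *-congˡ (congruent lin v≋w i)
    ; linear = λ y v w i → trans (*-congˡ (linear lin y v w i))
        (solve 4 (λ x a y b → x :* (a :+ y :* b) := x :* a :+ y :* (x :* b)) refl x _ y _) }

  -+-linear : ∀ {n} {J K L : Operator n} → Linear J → Linear K → Linear L →
              Linear (λ v i → J v i - K v i + L v i)
  -+-linear {J = J} {K} {L} J-lin K-lin L-lin = record
    { congruent = λ v≋w i → +-cong (+-cong (congruent J-lin v≋w i) (-‿cong (congruent K-lin v≋w i))) (congruent L-lin v≋w i)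
    ; linear = λ x v w i → trans
        (+-cong (+-cong (linear J-lin x v w i) (-‿cong (linear K-lin x v w i))) (linear L-lin x v w i))
        (solve 7 (λ a b c a′ b′ c′ x → (a :+ x :* a′) :- (b :+ x :* b′) :+ (c :+ x :* c′)
                     := (a :- b :+ c) :+ x :* (a′ :- b′ :+ c′))
           refl (J v i) (K v i) (L v i) (J w i) (K w i) (L w i) x) }

  δ : ∀ {n} → Fin n → Vector Carrier n
  δ j i = if does (i Fin.≟ j) then 1# else 0#

  δ-diagonal : ∀ {n} (i : Fin n) → δ i i ≡ 1#
  δ-diagonal i with i Fin.≟ i
  ... | yes _ = ≡.refl
  ... | no i≢i = ⊥-elim (i≢i ≡.refl)

  δ-off-diagonal : ∀ {n} {i j : Fin n} → i ≢ j → δ j i ≡ 0#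
  δ-off-diagonal {i = i} {j} i≢j with i Fin.≟ j
  ... | yes i≡j = ⊥-elim (i≢j i≡j)
  ... | no _ = ≡.refl

  sum-single : ∀ {n} (i : Fin n) (t : Vector Carrier n) → (∀ j → j ≢ i → t j ≈ 0#) → sum t ≈ t i
  sum-single {suc n} i t t≈0 = begin
    sum t                             ≈⟨ sum-remove {i = i} t ⟩
    t i + sum (λ j → t (punchIn i j)) ≈⟨ +-congˡ (sum-zero {n} (λ j → t≈0 _ (punchInᵢ≢i i j))) ⟩
    t i + 0#                          ≈⟨ +-identityʳ _ ⟩
    t i                               ∎

  δ-expansion : ∀ {n} (v : Vector Carrier n) i → sum (λ j → v j * δ j i) ≈ v i
  δ-expansion {n} v i = begin
    sum (λ j → v j * δ j i)
      ≈⟨ sum-single i (λ j → v j * δ j i) (λ j j≢i → trans (*-congˡ (reflexive (δ-off-diagonal (j≢i ∘ ≡.sym)))) (zeroʳ _)) ⟩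
    v i * δ i i               ≈⟨ *-congˡ (reflexive (δ-diagonal i)) ⟩
    v i * 1#                  ≈⟨ *-identityʳ _ ⟩
    v i                       ∎

  matrix : ∀ {n} → Operator n → SquareMatrix n
  matrix L i j = L (δ j) i

  matrix-*ᵥ : ∀ {n} {L : Operator n} → Linear L → ∀ v → matrix L *ᵥ v ≋ L v
  matrix-*ᵥ {n} {L} lin v i = begin
    sum (λ j → L (δ j) i * v j)               ≈⟨ sum-cong-≋ {n} (λ j → *-comm _ _) ⟩
    sum (λ j → v j * L (δ j) i)               ≈⟨ sum-cong-≋ {n} (λ j → ·-homo lin (v j) (δ j) i) ⟨
    sum (λ j → L (v j · δ j) i)               ≈⟨ sum-homo lin (λ j → v j · δ j) i ⟨
    L (λ i → sum λ j → v j * δ j i) i         ≈⟨ congruent lin (δ-expansion v) i ⟩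
    L v i                                     ∎

  tr : ∀ {n} → Operator n → Carrier
  tr L = trace (matrix L)

-- Spectral decomposition for a sum of commuting idempotents.

module SpectralTheory {c ℓ₁ ℓ₂} (F : HeytingField c ℓ₁ ℓ₂) where
  open FieldProperties F
  open LinearOperators F

  sumBelow : ℕ → (ℕ → Carrier) → Carrier
  sumBelow zero f = 0#
  sumBelow (suc K) f = sumBelow K f + f K

  sumBelow-zero : ∀ K {f} → (∀ j → j < K → f j ≈ 0#) → sumBelow K f ≈ 0#
  sumBelow-zero zero _ = refl
  sumBelow-zero (suc K) f≈0 = trans (+-cong (sumBelow-zero K (λ j j<K → f≈0 j (ℕ.m<n⇒m<1+n j<K))) (f≈0 K ℕ.≤-refl)) (+-identityʳ 0#)

  sumBelow-single : ∀ {K k} f → k < K → (∀ j → j < K → j ≢ k → f j ≈ 0#) → sumBelow K f ≈ f k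
  sumBelow-single {suc K} {k} f k<1+K f≈0 with k ℕ.≟ K
  ... | yes ≡.refl = trans (+-congʳ (sumBelow-zero K (λ j j<K → f≈0 j (ℕ.m<n⇒m<1+n j<K) (ℕ.<⇒≢ j<K)))) (+-identityˡ _)
  ... | no k≢K = trans
    (+-cong (sumBelow-single f (ℕ.≤∧≢⇒< (s≤s⁻¹ k<1+K) k≢K) (λ j j<K → f≈0 j (ℕ.m<n⇒m<1+n j<K)))
            (f≈0 K ℕ.≤-refl (k≢K ∘ ≡.sym)))
    (+-identityʳ _)

  module _ {n : ℕ} where

    -- Multiplication by z on sequences of coefficients.
    shift : (ℕ → Operator n) → ℕ → Operator n
    shift L zero    = λ _ → 𝟎
    shift L (suc k) = L k

    -- The coefficient of zᵏ in the product of the operators (1 − Eᵢ) + z Eᵢ.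
    component : ∀ {M} → (Fin M → Operator n) → ℕ → Operator n
    component {zero}  E zero    v = v
    component {zero}  E (suc k) v = 𝟎
    component {suc M} E k v i =
      component E′ k v i - E zero (component E′ k v) i + E zero (shift (component E′) k v) i
      where E′ = E ∘ suc

    total : ∀ {M} → (Fin M → Operator n) → Operator n
    total E v i = sum λ j → E j v i

    product : ∀ {M} → (Fin M → Operator n) → Subset M → Operator n
    product E []            v = v
    product E (inside ∷ T)  v = E zero (product (E ∘ suc) T v)
    product E (outside ∷ T) v = product (E ∘ suc) T v

    Commuting : Operator n → Operator n → Set (c ⊔ ℓ₁)
    Commuting K L = ∀ v → K (L v) ≋ L (K v)

    shift-linear : ∀ {L} → (∀ k → Linear (L k)) → ∀ k → Linear (shift L k)
    shift-linear lin zero    = 𝟎-linear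
    shift-linear lin (suc k) = lin k

    component-linear : ∀ {M} {E : Fin M → Operator n} → (∀ i → Linear (E i)) → ∀ k → Linear (component E k)
    component-linear {zero} lin zero = id-linear
    component-linear {zero} lin (suc k) = 𝟎-linear
    component-linear {suc M} lin k = -+-linear (IH k) (∘-linear (lin zero) (IH k))
      (∘-linear (lin zero) (shift-linear IH k))
      where IH = component-linear (lin ∘ suc)

    -- A product of M factors that are linear in z has degree at most M.
    component-vanishes : ∀ {M} {E : Fin M → Operator n} → (∀ i → Linear (E i)) →
                         ∀ {k} → M < k → ∀ v → component E k v ≋ 𝟎
    component-vanishes {zero} lin {suc k} M<k v i = refl
    component-vanishes {suc M} lin {suc k} (s≤s M<k) v i = begin
      _ ≈⟨ +-cong (+-cong (IH (ℕ.m<n⇒m<1+n M<k) v i)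
                          (-‿cong (vanishing (lin zero) (IH (ℕ.m<n⇒m<1+n M<k) v) i)))
                  (vanishing (lin zero) (IH M<k v) i) ⟩
      0# - 0# + 0#   ≈⟨ +-identityʳ _ ⟩
      0# - 0#        ≈⟨ -‿inverseʳ 0# ⟩
      0#             ∎
      where IH = component-vanishes (lin ∘ suc)

    -- At z = 1 every factor (1 - Eᵢ) + z Eᵢ becomes 1, so the coefficients resolve the identity.
    sumBelow-component : ∀ {M} {E : Fin M → Operator n} → (∀ i → Linear (E i)) →
                   ∀ v i → sumBelow (suc M) (λ k → component E k v i) ≈ v i
    sumBelow-component {zero} lin v i = +-identityˡ _
    sumBelow-component {suc M} {E} lin v i = begin
      sumBelow (suc (suc M)) (λ k → component E k v i)
        ≈⟨ telescope (suc M) ⟩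
      sumBelow (suc M) (λ k → w k i) + w (suc M) i - E zero (w (suc M)) i
        ≈⟨ +-cong (+-cong (sumBelow-component (lin ∘ suc) v i) (w≋𝟎 i)) (-‿cong (vanishing (lin zero) w≋𝟎 i)) ⟩
      v i + 0# - 0#   ≈⟨ trans (x-0≈x _) (+-identityʳ _) ⟩
      v i             ∎
      where
      w = λ k → component (E ∘ suc) k v
      w≋𝟎 : w (suc M) ≋ 𝟎
      w≋𝟎 = component-vanishes (lin ∘ suc) ℕ.≤-refl v
      -- The term -E₀ w_k of coefficient k cancels against E₀ w_k in coefficient k + 1; only the
      -- last one is left over.
      telescope : ∀ K → sumBelow (suc K) (λ k → component E k v i) ≈ sumBelow (suc K) (λ k → w k i) - E zero (w K) i
      telescope zero = begin
        0# + (w 0 i - E zero (w 0) i + E zero 𝟎 i)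
          ≈⟨ trans (+-congˡ (trans (+-congˡ (zero-homo (lin zero) i)) (+-identityʳ _))) (sym (+-assoc _ _ _)) ⟩
        0# + w 0 i - E zero (w 0) i ∎
      telescope (suc K) = begin
        sumBelow (suc K) (λ k → component E k v i) + (w (suc K) i - E zero (w (suc K)) i + E zero (w K) i)
          ≈⟨ +-congʳ (telescope K) ⟩
        sumBelow (suc K) (λ k → w k i) - E zero (w K) i + (w (suc K) i - E zero (w (suc K)) i + E zero (w K) i)
          ≈⟨ solve 4 (λ s a b d → s :- a :+ (b :- d :+ a) := s :+ b :- d) refl _ _ _ _ ⟩
        sumBelow (suc K) (λ k → w k i) + w (suc K) i - E zero (w (suc K)) i ∎

    shift-commuting : ∀ {L K} → Linear L → (∀ k → Commuting L (K k)) → ∀ k → Commuting L (shift K k)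
    shift-commuting L-lin comm zero v = zero-homo L-lin
    shift-commuting L-lin comm (suc k) v = comm k v

    component-commuting : ∀ {M} {E : Fin M → Operator n} {L} → (∀ i → Linear (E i)) → Linear L →
                          (∀ i → Commuting L (E i)) → ∀ k → Commuting L (component E k)
    component-commuting {zero} lin L-lin comm zero v i = refl
    component-commuting {zero} lin L-lin comm (suc k) v = zero-homo L-lin
    component-commuting {suc M} {E} {L} lin L-lin comm k v i = begin
      L (component E k v) i
        ≈⟨ -+-homo L-lin _ _ _ i ⟩
      L (w k) i - L (E zero (w k)) i + L (E zero (shift (component E′) k v)) i
        ≈⟨ +-cong (+-cong (IH k v i) (-‿cong (through (IH k) i)))
                  (through (shift-commuting L-lin IH k) i) ⟩
      component E k (L v) i ∎
      where
      E′ = E ∘ suc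
      w = λ k → component E′ k v
      IH = component-commuting (lin ∘ suc) L-lin (comm ∘ suc)
      through : ∀ {K} → Commuting L K → L (E zero (K v)) ≋ E zero (K (L v))
      through comm′ i = trans (comm zero _ i) (congruent (lin zero) (comm′ v) i)

  record CommutingIdempotents {n M} (E : Fin M → Operator n) : Set (c ⊔ ℓ₁) where
    field
      linears    : ∀ i → Linear (E i)
      idempotent : ∀ i v → E i (E i v) ≋ E i v
      commuting  : ∀ i j → Commuting (E i) (E j)

    total-linear : Linear (total E)
    total-linear = sum-linear linears

    total-commuting : ∀ i → Commuting (total E) (E i)
    total-commuting i v k = sym (trans (sum-homo (linears i) (λ j → E j v) k)
      (sum-cong-≋ {M} (λ j → commuting i j v k)))

  open CommutingIdempotents

  tail : ∀ {n M} {E : Fin (suc M) → Operator n} → CommutingIdempotents E → CommutingIdempotents (E ∘ suc)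
  tail ci = record
    { linears    = linears ci ∘ suc
    ; idempotent = idempotent ci ∘ suc
    ; commuting  = λ i j → commuting ci (suc i) (suc j)
    }

  -- In the recursion for the coefficient of zᵏ, E₀ kills w - E₀ w and fixes E₀ w⁻, while the other
  -- idempotents together act as k on w and as k - 1 on w⁻.
  total-component : ∀ {n M} {E : Fin M → Operator n} → CommutingIdempotents E → ∀ k v →
                    total E (component E k v) ≋ ⟦ k ⟧ · component E k v
  total-component {M = zero} ci zero v i = sym (zeroˡ _)
  total-component {M = zero} ci (suc k) v i = sym (zeroʳ _)
  total-component {n} {suc M} {E} ci k v i = begin
    E₀ u i + S u i
      ≈⟨ +-cong first rest ⟩
    E₀ w⁻ i + (⟦ k ⟧ * w i - ⟦ k ⟧ * E₀ w i + E₀ (S w⁻) i)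
      ≈⟨ solve 4 (λ a b c d → a :+ (b :- c :+ d) := b :- c :+ (d :+ a)) refl _ _ _ _ ⟩
    ⟦ k ⟧ * w i - ⟦ k ⟧ * E₀ w i + (E₀ (S w⁻) i + E₀ w⁻ i)
      ≈⟨ +-congˡ (trans (sym (+-homo E₀-lin _ _ i)) (trans (congruent E₀-lin (lowered k) i) (·-homo E₀-lin ⟦ k ⟧ w⁻ i))) ⟩
    ⟦ k ⟧ * w i - ⟦ k ⟧ * E₀ w i + ⟦ k ⟧ * E₀ w⁻ i
      ≈⟨ solve 4 (λ k a b c → k :* a :- k :* b :+ k :* c := k :* (a :- b :+ c)) refl ⟦ k ⟧ _ _ _ ⟩
    ⟦ k ⟧ * (w i - E₀ w i + E₀ w⁻ i) ∎
    where
    E₀ = E zero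
    E₀-lin = linears ci zero
    E′ = E ∘ suc
    S = total E′
    S-lin = total-linear (tail ci)
    u = component E k v
    w = component E′ k v
    w⁻ = shift (component E′) k v
    S-E₀ : Commuting S E₀
    S-E₀ v k = sym (trans (sum-homo E₀-lin (λ j → E (suc j) v) k)
      (sum-cong-≋ {M} (λ j → commuting ci zero (suc j) v k)))
    first : E₀ u i ≈ E₀ w⁻ i
    first = begin
      E₀ u i                                  ≈⟨ -+-homo E₀-lin w (E₀ w) (E₀ w⁻) i ⟩
      E₀ w i - E₀ (E₀ w) i + E₀ (E₀ w⁻) i     ≈⟨ +-cong (+-congˡ (-‿cong (idempotent ci zero w i))) (idempotent ci zero w⁻ i) ⟩
      E₀ w i - E₀ w i + E₀ w⁻ i               ≈⟨ +-congʳ (-‿inverseʳ _) ⟩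
      0# + E₀ w⁻ i                            ≈⟨ +-identityˡ _ ⟩
      E₀ w⁻ i                                 ∎
    rest : S u i ≈ ⟦ k ⟧ * w i - ⟦ k ⟧ * E₀ w i + E₀ (S w⁻) i
    rest = begin
      S u i
        ≈⟨ -+-homo S-lin w (E₀ w) (E₀ w⁻) i ⟩
      S w i - S (E₀ w) i + S (E₀ w⁻) i
        ≈⟨ +-cong (+-cong (total-component (tail ci) k v i) (-‿cong (begin
             S (E₀ w) i            ≈⟨ S-E₀ w i ⟩
             E₀ (S w) i            ≈⟨ congruent E₀-lin (total-component (tail ci) k v) i ⟩
             E₀ (⟦ k ⟧ · w) i      ≈⟨ ·-homo E₀-lin ⟦ k ⟧ w i ⟩
             ⟦ k ⟧ * E₀ w i        ∎))) (S-E₀ w⁻ i) ⟩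
      ⟦ k ⟧ * w i - ⟦ k ⟧ * E₀ w i + E₀ (S w⁻) i ∎
    -- The eigenvalue k - 1 of `S` on w⁻ is stated as S w⁻ + w⁻ = k w⁻, which also holds at k = 0,
    -- where w⁻ is 0.
    lowered : ∀ k → (λ i → S (shift (component E′) k v) i + shift (component E′) k v i) ≋ ⟦ k ⟧ · shift (component E′) k v
    lowered zero i = begin
      S 𝟎 i + 0#   ≈⟨ +-identityʳ _ ⟩
      S 𝟎 i        ≈⟨ zero-homo S-lin i ⟩
      0#           ≈⟨ zeroˡ _ ⟨
      0# * 0#      ∎
    lowered (suc k) i = begin
      S (component E′ k v) i + component E′ k v i              ≈⟨ +-congʳ (total-component (tail ci) k v i) ⟩
      ⟦ k ⟧ * component E′ k v i + component E′ k v i          ≈⟨ +-congˡ (*-identityˡ _) ⟨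
      ⟦ k ⟧ * component E′ k v i + 1# * component E′ k v i     ≈⟨ solve 3 (λ k o x → k :* x :+ o :* x := (o :+ k) :* x) refl ⟦ k ⟧ 1# _ ⟩
      (1# + ⟦ k ⟧) * component E′ k v i                        ∎

  -- Coefficient j commutes with the total, so applying it to the eigenvector equation gives (ν - j)
  -- u = 0 for u = `component E j v`; only the k-th summand of the resolution of the identity
  -- survives. The hypothesis compares ν with the other j alone, so the lemma also serves for an
  -- eigenvalue not yet identified.
  eigenvector-component : ∀ {n M} {E : Fin M → Operator n} → CommutingIdempotents E →
    ∀ {ν v k} → k ≤ M → (∀ j → j ≤ M → j ≢ k → ν # ⟦ j ⟧) →
    total E v ≋ ν · v → component E k v ≋ v
  eigenvector-component {E = E} ci {ν} {v} {k} k≤M ν#j Sv≋νv i = begin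
    component E k v i                                ≈⟨ sumBelow-single (λ j → component E j v i) (s≤s k≤M) others ⟨
    sumBelow (suc _) (λ j → component E j v i)             ≈⟨ sumBelow-component (linears ci) v i ⟩
    v i                                              ∎
    where
    others : ∀ j → j < suc _ → j ≢ k → component E j v i ≈ 0#
    others j (s≤s j≤M) j≢k = x*y≈0⇒y≈0 (#⇒-#0 (ν#j j j≤M j≢k)) (begin
      (ν - ⟦ j ⟧) * u i            ≈⟨ solve 3 (λ a b x → (a :- b) :* x := a :* x :- b :* x) refl ν ⟦ j ⟧ (u i) ⟩
      ν * u i - ⟦ j ⟧ * u i        ≈⟨ +-cong (·-homo (component-linear (linears ci) j) ν v i) (-‿cong (total-component ci j v i)) ⟨
      component E j (ν · v) i - total E u i
        ≈⟨ +-cong (congruent (component-linear (linears ci) j) Sv≋νv i)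
                  (-‿cong (sym (component-commuting (linears ci) (total-linear ci) (total-commuting ci) j v i))) ⟨
      component E j (total E v) i - component E j (total E v) i ≈⟨ -‿inverseʳ _ ⟩
      0#                           ∎)
      where u = component E j v

  component⇒eigenvector : ∀ {n M} {E : Fin M → Operator n} → CommutingIdempotents E →
    ∀ {k v} → component E k v ≋ v → total E v ≋ ⟦ k ⟧ · v
  component⇒eigenvector {E = E} ci {k} {v} fix i = begin
    total E v i                   ≈⟨ congruent (total-linear ci) fix i ⟨
    total E (component E k v) i   ≈⟨ total-component ci k v i ⟩
    ⟦ k ⟧ * component E k v i     ≈⟨ *-congˡ (fix i) ⟩
    ⟦ k ⟧ * v i                   ∎

  -- Iterated differences: with φ j the trace of a product of j of the commuting
  -- idempotents, Δ φ r k is that of a product of k of them and of r complements 1 − Eᵢ.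
  Δ : (ℕ → Carrier) → ℕ → ℕ → Carrier
  Δ φ zero    j = φ j
  Δ φ (suc n) j = Δ φ n j - Δ φ n (suc j)

  tr-zero : ∀ {n} {L : Operator n} → (∀ v → L v ≋ 𝟎) → tr L ≈ 0#
  tr-zero {n} L≋𝟎 = sum-zero {n} (λ i → L≋𝟎 (δ i) i)

  -- `U` stands for the u idempotents already chosen, to which the recursion adds `E zero` on the
  -- right. The factor 1 - E₀ costs one more difference, the factor z E₀ one more chosen idempotent,
  -- and Pascal's rule joins the two branches.
  tr-component : ∀ {n M} {E : Fin M → Operator n} {U : Operator n} → (∀ i → Linear (E i)) → Linear U →
    ∀ φ u → (∀ T → tr (U ∘ product E T) ≈ φ (u ℕ.+ ∣ T ∣)) →
    ∀ r k → r ℕ.+ k ≡ M → tr (U ∘ component E k) ≈ ⟦ M C k ⟧ * Δ φ r (u ℕ.+ k)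
  tr-component {M = zero} {E} {U} lin U-lin φ u hyp zero zero _ = begin
    tr U                        ≈⟨ hyp [] ⟩
    φ (u ℕ.+ 0)                 ≈⟨ *-identityˡ _ ⟨
    1# * φ (u ℕ.+ 0)            ≈⟨ *-congʳ (+-identityʳ 1#) ⟨
    (1# + 0#) * φ (u ℕ.+ 0)     ∎
  tr-component {n} {suc M} {E} {U} lin U-lin φ u hyp r k r+k≡1+M = begin
    tr (U ∘ component E k)
      ≈⟨ sum-cong-≋ {n} (λ i → -+-homo U-lin (component E′ k (δ i)) _ _ i) ⟩
    sum (λ i → U (component E′ k (δ i)) i - U (E₀ (component E′ k (δ i))) i + U (E₀ (shift (component E′) k (δ i))) i)
      ≈⟨ trans (∑-distrib-+ {n} _ _) (+-congʳ (sum-- {n} _ _)) ⟩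
    tr (U ∘ component E′ k) - tr (U ∘ E₀ ∘ component E′ k) + tr (U ∘ E₀ ∘ shift (component E′) k)
      ≈⟨ step r k r+k≡1+M ⟩
    ⟦ suc M C k ⟧ * Δ φ r (u ℕ.+ k) ∎
    where
    E₀ = E zero
    E′ = E ∘ suc
    UE₀-lin = ∘-linear U-lin (lin zero)
    nC0≡1 : ∀ n → n C 0 ≡ 1
    nC0≡1 n = ≡.trans (nCk≡nC[n∸k] {0} {n} z≤n) (nCn≡1 n)
    IH : ∀ r k → r ℕ.+ k ≡ M → tr (U ∘ component E′ k) ≈ ⟦ M C k ⟧ * Δ φ r (u ℕ.+ k)
    IH = tr-component (lin ∘ suc) U-lin φ u (λ T → hyp (outside ∷ T))
    IH₀ : ∀ r k → r ℕ.+ k ≡ M → tr (U ∘ E₀ ∘ component E′ k) ≈ ⟦ M C k ⟧ * Δ φ r (suc u ℕ.+ k)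
    IH₀ = tr-component (lin ∘ suc) UE₀-lin φ (suc u) (λ T → trans (hyp (inside ∷ T)) (reflexive (≡.cong φ (ℕ.+-suc u ∣ T ∣))))
    vanish : ∀ {V : Operator n} {k} → Linear V → M < k → tr (V ∘ component E′ k) ≈ 0#
    vanish {V} V-lin M<k = tr-zero {n} {V ∘ component E′ _} (λ v → vanishing V-lin (component-vanishes (lin ∘ suc) M<k v))
    step : ∀ r k → r ℕ.+ k ≡ suc M →
           tr (U ∘ component E′ k) - tr (U ∘ E₀ ∘ component E′ k) + tr (U ∘ E₀ ∘ shift (component E′) k)
           ≈ ⟦ suc M C k ⟧ * Δ φ r (u ℕ.+ k)
    step zero (suc k) ≡.refl = begin
      _ ≈⟨ +-cong (+-cong (vanish U-lin ℕ.≤-refl) (-‿cong (vanish UE₀-lin ℕ.≤-refl))) (IH₀ 0 k ≡.refl) ⟩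
      0# - 0# + ⟦ k C k ⟧ * φ (suc u ℕ.+ k)         ≈⟨ trans (+-congʳ (-‿inverseʳ 0#)) (+-identityˡ _) ⟩
      ⟦ k C k ⟧ * φ (suc u ℕ.+ k)
        ≡⟨ ≡.cong₂ (λ a b → ⟦ a ⟧ * φ b) (≡.trans (nCn≡1 k) (≡.sym (nCn≡1 (suc k)))) (≡.sym (ℕ.+-suc u k)) ⟩
      ⟦ suc k C suc k ⟧ * φ (u ℕ.+ suc k)           ∎
    step (suc r) zero eq = begin
      _ ≈⟨ +-cong (+-cong (IH r 0 (ℕ.suc-injective eq)) (-‿cong (IH₀ r 0 (ℕ.suc-injective eq))))
                  (tr-zero {n} {U ∘ E₀ ∘ shift (component E′) 0} (λ _ → zero-homo UE₀-lin)) ⟩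
      ⟦ M C 0 ⟧ * Δ φ r (u ℕ.+ 0) - ⟦ M C 0 ⟧ * Δ φ r (suc u ℕ.+ 0) + 0#
        ≈⟨ +-identityʳ _ ⟩
      ⟦ M C 0 ⟧ * Δ φ r (u ℕ.+ 0) - ⟦ M C 0 ⟧ * Δ φ r (suc u ℕ.+ 0)
        ≈⟨ solve 3 (λ a b c → a :* b :- a :* c := a :* (b :- c)) refl _ _ _ ⟩
      ⟦ M C 0 ⟧ * Δ φ (suc r) (u ℕ.+ 0)
        ≡⟨ ≡.cong (λ a → ⟦ a ⟧ * Δ φ (suc r) (u ℕ.+ 0)) (≡.trans (nC0≡1 M) (≡.sym (nC0≡1 (suc M)))) ⟩
      ⟦ suc M C 0 ⟧ * Δ φ (suc r) (u ℕ.+ 0) ∎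
    step (suc r) (suc k) eq = begin
      _ ≈⟨ +-cong (+-cong (IH r (suc k) eq₁) (-‿cong (IH₀ r (suc k) eq₁))) (IH₀ (suc r) k eq₂) ⟩
      ⟦ M C suc k ⟧ * Δ φ r (u ℕ.+ suc k) - ⟦ M C suc k ⟧ * Δ φ r (suc u ℕ.+ suc k) + ⟦ M C k ⟧ * Δ φ (suc r) (suc u ℕ.+ k)
        ≡⟨ ≡.cong (λ b → ⟦ M C suc k ⟧ * Δ φ r (u ℕ.+ suc k) - ⟦ M C suc k ⟧ * Δ φ r (suc u ℕ.+ suc k) + ⟦ M C k ⟧ * Δ φ (suc r) b)
                  (≡.sym (ℕ.+-suc u k)) ⟩
      ⟦ M C suc k ⟧ * Δ φ r (u ℕ.+ suc k) - ⟦ M C suc k ⟧ * Δ φ r (suc (u ℕ.+ suc k)) + ⟦ M C k ⟧ * Δ φ (suc r) (u ℕ.+ suc k)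
        -- Both branches carry the same difference, so only the binomial coefficients remain to be
        -- added.
        ≈⟨ solve 4 (λ a b c d → a :* b :- a :* c :+ d :* (b :- c) := (d :+ a) :* (b :- c)) refl _ _ _ _ ⟩
      (⟦ M C k ⟧ + ⟦ M C suc k ⟧) * Δ φ (suc r) (u ℕ.+ suc k)
        ≈⟨ *-congʳ (×-homo-+ 1# (M C k) (M C suc k)) ⟨
      ⟦ (M C k) ℕ.+ (M C suc k) ⟧ * Δ φ (suc r) (u ℕ.+ suc k)
        ≡⟨ ≡.cong (λ a → ⟦ a ⟧ * Δ φ (suc r) (u ℕ.+ suc k)) (nCk+nC[k+1]≡[n+1]C[k+1] M k) ⟩
      ⟦ suc M C suc k ⟧ * Δ φ (suc r) (u ℕ.+ suc k) ∎
      where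
      eq₁ : r ℕ.+ suc k ≡ M
      eq₁ = ℕ.suc-injective eq
      eq₂ : suc r ℕ.+ k ≡ M
      eq₂ = ≡.trans (≡.sym (ℕ.+-suc r k)) eq₁

-- Arithmetic of the multiplicities.

-- The number of proper colourings of a cycle of length n + 1 with p + 1 colours, divided
-- by p + 1.  The recursion f (n + 1) = pⁿ⁺¹ − f n is unfolded once to avoid subtraction.
cycleDim : ℕ → ℕ → ℕ
cycleDim p zero          = 0
cycleDim p (suc zero)    = p
cycleDim p (suc (suc n)) = p ^ suc n ℕ.* ℕ.pred p ℕ.+ cycleDim p n

-- Deletion and contraction of an edge: a path on n + 2 vertices has (p + 1) p^(n + 1) colourings,
-- and its ends have either different colours or the same.
cycleDim-suc : ∀ p n → cycleDim p (suc n) ℕ.+ cycleDim p n ≡ p ^ suc n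
cycleDim-suc p zero = ≡.trans (ℕ.+-identityʳ p) (≡.sym (ℕ.*-identityʳ p))
-- `pred 0` is 0 and not -1, but here it is multiplied by `0 ^ suc n`, which is 0.
cycleDim-suc zero (suc n) = ≡.trans (ℕ.+-comm (cycleDim 0 n) _) (cycleDim-suc zero n)
cycleDim-suc (suc p) (suc n) = begin
  P ℕ.* p ℕ.+ cycleDim (suc p) n ℕ.+ cycleDim (suc p) (suc n)     ≡⟨ ℕ.+-assoc (P ℕ.* p) _ _ ⟩
  P ℕ.* p ℕ.+ (cycleDim (suc p) n ℕ.+ cycleDim (suc p) (suc n))
    ≡⟨ ≡.cong (λ t → P ℕ.* p ℕ.+ t) (≡.trans (ℕ.+-comm (cycleDim (suc p) n) _) (cycleDim-suc (suc p) n)) ⟩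
  P ℕ.* p ℕ.+ P        ≡⟨ ≡.trans (ℕ.+-comm (P ℕ.* p) P) (≡.sym (ℕ.*-suc P p)) ⟩
  P ℕ.* suc p          ≡⟨ ℕ.*-comm P (suc p) ⟩
  suc p ℕ.* P          ∎
  where
  open ≡.≡-Reasoning
  P = suc p ^ suc n

-- The alternating power comes from solving f (n + 1) = p^(n + 1) - f n. The equation is multiplied
-- by p + 1 to keep the division by q out of the induction.
cycleDim-closed : ∀ p n → + (suc p ℕ.* cycleDim p n) ≡ + p ℤ.* ((+ p) ℤ.^ n ℤ.- -1ℤ ℤ.^ n)
cycleDim-closed p zero = ≡.trans (≡.cong +_ (ℕ.*-zeroʳ (suc p))) (≡.sym (ℤ.*-zeroʳ (+ p)))
cycleDim-closed p (suc n) = begin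
  + (suc p ℕ.* f₁)
    ≡⟨ ℤ.pos-* (suc p) f₁ ⟩
  + suc p ℤ.* + f₁
    ≡⟨ solve 3 (λ q a b → q :* a := q :* (a :+ b) :- q :* b) ≡.refl (+ suc p) (+ f₁) (+ f₀) ⟩
  + suc p ℤ.* (+ f₁ ℤ.+ + f₀) ℤ.- + suc p ℤ.* + f₀
    ≡⟨ ≡.cong₂ (λ a b → + suc p ℤ.* a ℤ.- b)
         (≡.trans (≡.cong +_ (cycleDim-suc p n)) (pos-^ p (suc n)))
         (≡.trans (≡.sym (ℤ.pos-* (suc p) f₀)) (cycleDim-closed p n)) ⟩
  + suc p ℤ.* (+ p ℤ.* P) ℤ.- + p ℤ.* (P ℤ.- S)
    ≡⟨ solve 3 (λ p P S → (con 1ℤ :+ p) :* (p :* P) :- p :* (P :- S)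
                       := p :* (p :* P :- con -1ℤ :* S)) ≡.refl (+ p) P S ⟩
  + p ℤ.* (+ p ℤ.* P ℤ.- -1ℤ ℤ.* S) ∎
  where
  open ≡.≡-Reasoning
  open ℤ.+-*-Solver
  f₁ = cycleDim p (suc n)
  f₀ = cycleDim p n
  P = (+ p) ℤ.^ n
  S = -1ℤ ℤ.^ n
  pos-^ : ∀ p n → + (p ^ n) ≡ (+ p) ℤ.^ n
  pos-^ p zero = ≡.refl
  pos-^ p (suc n) = ≡.trans (ℤ.pos-* p (p ^ n)) (≡.cong (+ p ℤ.*_) (pos-^ p n))

multiplicity-closed : ∀ m k p → (+ ((suc m C k) ℕ.* cycleDim p (m ∸ k))) ℚ./ 1 ≡ multiplicity m k (suc p)
-- `mkℚᵘ` stores the denominator minus one: `0` stands for 1 and `p` for q. The factor `+ q - 1ℤ`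
-- computes to `+ p`.
multiplicity-closed m k p = ℚ.fromℚᵘ-cong {ℚᵘ.mkℚᵘ (+ (B ℕ.* f)) 0} {ℚᵘ.mkℚᵘ N p} (ℚᵘ.*≡* (begin
  + (B ℕ.* f) ℤ.* + suc p          ≡⟨ ≡.cong (ℤ._* + suc p) (ℤ.pos-* B f) ⟩
  + B ℤ.* + f ℤ.* + suc p          ≡⟨ solve 3 (λ B f q → B :* f :* q := B :* (q :* f)) ≡.refl (+ B) (+ f) (+ suc p) ⟩
  + B ℤ.* (+ suc p ℤ.* + f)        ≡⟨ ≡.cong (+ B ℤ.*_) (≡.trans (≡.sym (ℤ.pos-* (suc p) f)) (cycleDim-closed p (m ∸ k))) ⟩
  + B ℤ.* (+ p ℤ.* R)              ≡⟨ ℤ.*-assoc (+ B) (+ p) R ⟨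
  + B ℤ.* + p ℤ.* R                ≡⟨ ℤ.*-identityʳ _ ⟨
  N ℤ.* + 1                        ∎))
  where
  open ≡.≡-Reasoning
  open ℤ.+-*-Solver
  B = suc m C k
  f = cycleDim p (m ∸ k)
  R = (+ p) ℤ.^ (m ∸ k) ℤ.- -1ℤ ℤ.^ (m ∸ k)
  N = + B ℤ.* + p ℤ.* R

-- Eigenvalues of the sum and dimensions of its eigenspaces.

module EigenspaceDimensions {c ℓ₁ ℓ₂} (F : HeytingField c ℓ₁ ℓ₂)
                            (char0 : Matrices.CharacteristicZero F) where
  open FieldProperties F
  open IdempotentRank F char0
  open LinearOperators F
  open SpectralTheory F
  open CommutingIdempotents

  <⇒⟦⟧# : ∀ {j k} → j < k → ⟦ k ⟧ # ⟦ j ⟧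
  <⇒⟦⟧# {j} {k} j<k with r , ≡.refl ← ℕ.m≤n⇒∃[o]m+o≡n j<k = -#0⇒# (#-congʳ (begin
    ⟦ suc r ⟧                     ≈⟨ solve 2 (λ a b → a := b :+ a :- b) refl ⟦ suc r ⟧ ⟦ j ⟧ ⟩
    ⟦ j ⟧ + ⟦ suc r ⟧ - ⟦ j ⟧     ≈⟨ +-congʳ (×-homo-+ 1# j (suc r)) ⟨
    ⟦ j ℕ.+ suc r ⟧ - ⟦ j ⟧       ≡⟨ ≡.cong (λ a → ⟦ a ⟧ - ⟦ j ⟧) (ℕ.+-suc j r) ⟩
    ⟦ suc j ℕ.+ r ⟧ - ⟦ j ⟧       ∎) (char0 r))

  ≢⇒⟦⟧# : ∀ {j k} → j ≢ k → ⟦ j ⟧ # ⟦ k ⟧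
  ≢⇒⟦⟧# {j} {k} j≢k with ℕ.<-cmp j k
  ... | tri< j<k _ _ = #-sym (<⇒⟦⟧# j<k)
  ... | tri≈ _ j≡k _ = ⊥-elim (j≢k j≡k)
  ... | tri> _ _ k<j = <⇒⟦⟧# k<j

  hasDimension-resp-⇔ : ∀ {n d p p′} {W : Vector Carrier n → Set p} {W′ : Vector Carrier n → Set p′} →
    (∀ {v} → W v → W′ v) → (∀ {v} → W′ v → W v) → HasDimension W d → HasDimension W′ d
  hasDimension-resp-⇔ W⇒W′ W′⇒W (b , b∈W , indep , span) =
    b , (λ j → W⇒W′ (b∈W j)) , indep , λ v v∈W′ → span v (W′⇒W v∈W′)

  dimension-zero⇒vanishes : ∀ {n p} {W : Vector Carrier n → Set p} → HasDimension W 0 → ∀ {v} → W v → v ≋ 𝟎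
  dimension-zero⇒vanishes (_ , _ , _ , span) {v} v∈W with _ , v≋ ← span v v∈W = v≋

  dimension-suc⇒nonzero : ∀ {n d p} {W : Vector Carrier n → Set p} → HasDimension W (suc d) →
                          ∃[ v ] ¬ (v ≋ 𝟎) × W v
  dimension-suc⇒nonzero {d = d} (b , b∈W , indep , _) = b zero , b₀≉𝟎 , b∈W zero
    where
    b₀≉𝟎 : ¬ (b zero ≋ 𝟎)
    b₀≉𝟎 b₀≋𝟎 = #-irrefl (trans (sym (reflexive (δ-diagonal {suc d} zero))) (indep (δ zero) combination zero)) 1#0
      where
      combination : linearCombination (δ zero) b ≋ 𝟎
      combination i = trans (+-cong (trans (*-congˡ (b₀≋𝟎 i)) (zeroʳ _)) (sum-zero {d} (λ j → zeroˡ _))) (+-identityʳ 0#)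

  -- The eigenspace is the fixed space of `component E k`. The columns of its matrix are themselves
  -- eigenvectors, hence absorbed, which makes the matrix idempotent.
  dimension-eigenspace : ∀ {n M d k} {E : Fin M → Operator n} → CommutingIdempotents E → k ≤ M →
    tr (component E k) ≈ ⟦ d ⟧ → HasDimension (λ v → total E v ≋ ⟦ k ⟧ · v) d
  dimension-eigenspace {d = d} {k} {E} ci k≤M tr≈d = hasDimension-resp-⇔
    (λ fix → component⇒eigenvector ci (λ i → trans (sym (matrix-*ᵥ lin _ i)) (fix i)))
    (λ eig i → trans (matrix-*ᵥ lin _ i) (absorb eig i))
    (dimension-fixed d (matrix (component E k)) idem tr≈d)
    where
    lin = component-linear (linears ci) k
    absorb : ∀ {v} → total E v ≋ ⟦ k ⟧ · v → component E k v ≋ v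
    absorb = eigenvector-component ci k≤M (λ j _ j≢k → ≢⇒⟦⟧# (j≢k ∘ ≡.sym))
    idem : Idempotent (matrix (component E k))
    idem i j = trans (matrix-*ᵥ lin (component E k (δ j)) i)
                     (absorb (total-component ci k (δ j)) i)

  -- Equality of `x` with a given `xs j` cannot be tested. One candidate is kept instead: it and the
  -- next value are apart, so by cotransitivity `x` is apart from one of the two, which is
  -- discarded.
  apart-from-others : ∀ {M} (xs : Fin (suc M) → Carrier) → (∀ {i j} → i ≢ j → xs i # xs j) →
                      ∀ x → ∃[ k ] (∀ j → j ≢ k → x # xs j)
  apart-from-others {zero} xs apart x = zero , λ { zero 0≢0 → ⊥-elim (0≢0 ≡.refl) }
  apart-from-others {suc M} xs apart x
    with k , rest ← apart-from-others (xs ∘ suc) (λ i≢j → apart (i≢j ∘ Fin.suc-injective)) x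
    with #-cotrans (apart {zero} {suc k} (λ ())) x
  ... | inj₁ x₀#x = suc k , λ { zero _ → #-sym x₀#x ; (suc j) j≢k → rest j (j≢k ∘ ≡.cong suc) }
  ... | inj₂ x#xₖ = zero , λ { zero 0≢0 → ⊥-elim (0≢0 ≡.refl) ; (suc j) _ → other j }
    where
    other : ∀ j → x # xs (suc j)
    other j with j Fin.≟ k
    ... | yes ≡.refl = x#xₖ
    ... | no j≢k = rest j j≢k

  -- Once ν is apart from all candidates but k, its eigenvector is also one for k. If ν and k were
  -- apart the vector would be 0; so they are not, and tightness makes them equal.
  total-eigenvalue : ∀ {n M} {E : Fin M → Operator n} → CommutingIdempotents E → ∀ {ν v} →
    ¬ (v ≋ 𝟎) → total E v ≋ ν · v → ∃[ k ] k ≤ M × ν ≈ ⟦ k ⟧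
  total-eigenvalue {M = M} {E} ci {ν} {v} v≉𝟎 eig
    with k , others ← apart-from-others {M} (⟦_⟧ ∘ toℕ) (λ i≢j → ≢⇒⟦⟧# (i≢j ∘ toℕ-injective)) ν
    = toℕ k , s≤s⁻¹ (toℕ<n k) , proj₁ (tight ν ⟦ toℕ k ⟧) ν¬#k
    where
    others′ : ∀ j → j ≤ M → j ≢ toℕ k → ν # ⟦ j ⟧
    others′ j j≤M j≢k = ≡.subst (λ i → ν # ⟦ i ⟧) (toℕ-fromℕ< (s≤s j≤M))
      (others (fromℕ< (s≤s j≤M)) (λ eq → j≢k (≡.trans (≡.sym (toℕ-fromℕ< (s≤s j≤M))) (≡.cong toℕ eq))))
    eigₖ : total E v ≋ ⟦ toℕ k ⟧ · v
    eigₖ = component⇒eigenvector ci (eigenvector-component ci (s≤s⁻¹ (toℕ<n k)) others′ eig)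
    ν¬#k : ¬ (ν # ⟦ toℕ k ⟧)
    ν¬#k ν#k = v≉𝟎 (λ i → x*y≈0⇒y≈0 (#⇒-#0 ν#k) (begin
      (ν - ⟦ toℕ k ⟧) * v i         ≈⟨ solve 3 (λ a b x → (a :- b) :* x := a :* x :- b :* x) refl ν ⟦ toℕ k ⟧ (v i) ⟩
      ν * v i - ⟦ toℕ k ⟧ * v i     ≈⟨ +-cong (sym (eig i)) (-‿cong (sym (eigₖ i))) ⟩
      total E v i - total E v i     ≈⟨ -‿inverseʳ _ ⟩
      0#                            ∎))

  module _ (m p : ℕ) where
    private
      -- Truncated subtraction gives `φ (suc m)` the value 1, the trace of the product of all m + 1
      -- idempotents.
      φ : ℕ → Carrier
      φ j = ⟦ suc p ^ (m ∸ j) ⟧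

      -‿⟦⟧ : ∀ {a} b d → a ≡ b ℕ.+ d → ⟦ a ⟧ - ⟦ d ⟧ ≈ ⟦ b ⟧
      -‿⟦⟧ b d ≡.refl = begin
        ⟦ b ℕ.+ d ⟧ - ⟦ d ⟧       ≈⟨ +-congʳ (×-homo-+ 1# b d) ⟩
        ⟦ b ⟧ + ⟦ d ⟧ - ⟦ d ⟧     ≈⟨ solve 2 (λ b d → b :+ d :- d := b) refl ⟦ b ⟧ ⟦ d ⟧ ⟩
        ⟦ b ⟧                     ∎

    -- Up to index m the sequence is geometric, and q^(r + 1) - q^r = p q^r turns every difference
    -- into a factor p.
    Δ-power : ∀ n j r → r ℕ.+ (n ℕ.+ j) ≡ m → Δ φ n j ≈ ⟦ p ^ n ℕ.* suc p ^ r ⟧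
    Δ-power zero j r eq = reflexive (≡.cong ⟦_⟧ (≡.trans (≡.cong (suc p ^_)
      (≡.trans (≡.cong (_∸ j) (≡.sym eq)) (ℕ.m+n∸n≡m r j))) (≡.sym (ℕ.+-identityʳ _))))
    Δ-power (suc n) j r eq = begin
      Δ φ n j - Δ φ n (suc j)
        ≈⟨ +-cong (Δ-power n j (suc r) (≡.trans (≡.sym (ℕ.+-suc r (n ℕ.+ j))) eq))
                  (-‿cong (Δ-power n (suc j) r (≡.trans (≡.cong (r ℕ.+_) (ℕ.+-suc n j)) eq))) ⟩
      ⟦ p ^ n ℕ.* suc p ^ suc r ⟧ - ⟦ p ^ n ℕ.* suc p ^ r ⟧
        ≈⟨ -‿⟦⟧ (p ^ suc n ℕ.* suc p ^ r) (p ^ n ℕ.* suc p ^ r) (ℕ-solve 3 (λ P p Q → P :*′ (Q :+′ p :*′ Q) :=′ p :*′ P :*′ Q :+′ P :*′ Q) ≡.refl (p ^ n) p (suc p ^ r)) ⟩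
      ⟦ p ^ suc n ℕ.* suc p ^ r ⟧ ∎
      where open ℕ.+-*-Solver using () renaming (solve to ℕ-solve; _:*_ to _:*′_; _:+_ to _:+′_; _:=_ to _:=′_)

    -- Here the differences reach index m + 1, where `φ` repeats the value 1. The first one is
    -- therefore 0, and the next ones follow the recursion f (n + 1) = p^(n + 1) - f n.
    Δ-cycle : ∀ n j → n ℕ.+ j ≡ m → Δ φ (suc n) j ≈ ⟦ cycleDim p n ⟧
    Δ-cycle zero j ≡.refl = begin
      φ j - φ (suc j)    ≡⟨ ≡.cong₂ (λ a b → ⟦ suc p ^ a ⟧ - ⟦ suc p ^ b ⟧) (ℕ.n∸n≡0 j) (ℕ.m≤n⇒m∸n≡0 (ℕ.n≤1+n j)) ⟩
      ⟦ 1 ⟧ - ⟦ 1 ⟧      ≈⟨ -‿inverseʳ _ ⟩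
      0#                 ∎
    Δ-cycle (suc n) j eq = begin
      Δ φ (suc n) j - Δ φ (suc n) (suc j)
        ≈⟨ +-cong (Δ-power (suc n) j 0 eq) (-‿cong (Δ-cycle n (suc j) (≡.trans (ℕ.+-suc n j) eq))) ⟩
      ⟦ p ^ suc n ℕ.* 1 ⟧ - ⟦ cycleDim p n ⟧
        ≈⟨ -‿⟦⟧ (cycleDim p (suc n)) (cycleDim p n) (≡.trans (ℕ.*-identityʳ (p ^ suc n)) (≡.sym (cycleDim-suc p n))) ⟩
      ⟦ cycleDim p (suc n) ⟧ ∎

    module _ {n} {E : Fin (suc m) → Operator n} (linear : ∀ i → Linear (E i))
             (tr-product : ∀ T → tr (product E T) ≈ ⟦ suc p ^ (m ∸ ∣ T ∣) ⟧) where

      tr-component-≤ : ∀ {k} → k ≤ m → tr (component E k) ≈ ⟦ (suc m C k) ℕ.* cycleDim p (m ∸ k) ⟧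
      tr-component-≤ {k} k≤m = begin
        tr (component E k)
          ≈⟨ tr-component linear id-linear φ 0 tr-product (suc (m ∸ k)) k (≡.cong suc (ℕ.m∸n+n≡m k≤m)) ⟩
        ⟦ suc m C k ⟧ * Δ φ (suc (m ∸ k)) k             ≈⟨ *-congˡ (Δ-cycle (m ∸ k) k (ℕ.m∸n+n≡m k≤m)) ⟩
        ⟦ suc m C k ⟧ * ⟦ cycleDim p (m ∸ k) ⟧          ≈⟨ ×1-homo-* (suc m C k) _ ⟨
        ⟦ (suc m C k) ℕ.* cycleDim p (m ∸ k) ⟧            ∎

      tr-component-top : tr (component E (suc m)) ≈ ⟦ 1 ⟧
      tr-component-top = begin
        tr (component E (suc m))
          ≈⟨ tr-component linear id-linear φ 0 tr-product 0 (suc m) ≡.refl ⟩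
        ⟦ suc m C suc m ⟧ * φ (suc m)
          ≡⟨ ≡.cong₂ (λ a b → ⟦ a ⟧ * ⟦ suc p ^ b ⟧) (nCn≡1 (suc m)) (ℕ.m≤n⇒m∸n≡0 (ℕ.n≤1+n m)) ⟩
        ⟦ 1 ⟧ * ⟦ 1 ⟧     ≈⟨ ×1-homo-* 1 1 ⟨
        ⟦ 1 ⟧             ∎

-- The group and the partitions in terms of indices.

private
  funToFin-cong : ∀ {m n} {f h : Fin m → Fin n} → f ≗ h → funToFin f ≡ funToFin h
  funToFin-cong {zero}  p = ≡.refl
  funToFin-cong {suc m} p = ≡.cong₂ combine (p zero) (funToFin-cong (p ∘ suc))

finToFun-injective : ∀ {m n} {k l : Fin (n ℕ.^ m)} → finToFun {n} {m} k ≗ finToFun l → k ≡ l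
finToFun-injective {m} {n} {k} {l} k≗l = begin
  k                                ≡⟨ funToFin-finToFin {m} {n} k ⟨
  funToFin (finToFun {n} {m} k)    ≡⟨ funToFin-cong k≗l ⟩
  funToFin (finToFun {n} {m} l)    ≡⟨ funToFin-finToFin {m} {n} l ⟩
  l                                ∎
  where open ≡.≡-Reasoning

-- The use of m ≥ 2: changing one coordinate leaves another one unchanged, and that one recognises a
-- translation.
another : ∀ {m} → 2 ≤ m → (i : Fin m) → ∃[ j ] j ≢ i
another (s≤s (s≤s _)) zero    = suc zero , λ ()
another (s≤s (s≤s _)) (suc i) = zero , λ ()

module Multiplication {g ℓ} (G : Group g ℓ) {q : ℕ} (order : HasOrder G q) where
  open Group G
  open Algebra.Properties.Group G using (∙-cancelʳ)
  open Inverse order using (to; from; to-cong; from-cong; strictlyInverseˡ; strictlyInverseʳ)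

  infixr 7 _⊙_

  -- Transported to indices, the multiplication satisfies its laws up to `≡`, so that arguments of
  -- vectors can be rewritten and sums over the group permuted.
  _⊙_ : Fin q → Fin q → Fin q
  a ⊙ b = from (to a ∙ to b)

  e : Fin q
  e = from ε

  to-injective : ∀ {a b} → to a ≈ to b → a ≡ b
  to-injective {a} {b} p = ≡.trans (≡.sym (strictlyInverseʳ a)) (≡.trans (from-cong p) (strictlyInverseʳ b))

  to-⊙ : ∀ a b → to (a ⊙ b) ≈ to a ∙ to b
  to-⊙ a b = strictlyInverseˡ _

  ⊙-assoc : ∀ a b d → (a ⊙ b) ⊙ d ≡ a ⊙ (b ⊙ d)
  ⊙-assoc a b d = from-cong (trans (∙-congʳ (to-⊙ a b)) (trans (assoc _ _ _) (∙-congˡ (sym (to-⊙ b d)))))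

  e-⊙ : ∀ a → e ⊙ a ≡ a
  e-⊙ a = ≡.trans (from-cong (trans (∙-congʳ (strictlyInverseˡ ε)) (identityˡ _))) (strictlyInverseʳ a)

  ⊙-cancelʳ : ∀ x {a b} → a ⊙ x ≡ b ⊙ x → a ≡ b
  ⊙-cancelʳ x {a} {b} p = to-injective (∙-cancelʳ (to x) (to a) (to b)
    (trans (sym (to-⊙ a x)) (trans (to-cong p) (to-⊙ b x))))

  ⊙-fixes⇒e : ∀ x {a} → a ⊙ x ≡ x → a ≡ e
  ⊙-fixes⇒e x p = ⊙-cancelʳ x (≡.trans p (≡.sym (e-⊙ x)))

  left : Fin q → Permutation′ q
  left a = permutation (a ⊙_) (λ b → from (to a ⁻¹ ∙ to b))
    (λ b → ≡.trans (from-cong (trans (∙-congˡ (strictlyInverseˡ _))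
       (trans (sym (assoc _ _ _)) (trans (∙-congʳ (inverseʳ _)) (identityˡ _))))) (strictlyInverseʳ b))
    (λ b → ≡.trans (from-cong (trans (∙-congˡ (strictlyInverseˡ _))
       (trans (sym (assoc _ _ _)) (trans (∙-congʳ (inverseˡ _)) (identityˡ _))))) (strictlyInverseʳ b))

  right : Fin q → Permutation′ q
  right a = permutation (_⊙ a) (λ b → from (to b ∙ to a ⁻¹))
    (λ b → ≡.trans (from-cong (trans (∙-congʳ (strictlyInverseˡ _))
       (trans (assoc _ _ _) (trans (∙-congˡ (inverseˡ _)) (identityʳ _))))) (strictlyInverseʳ b))
    (λ b → ≡.trans (from-cong (trans (∙-congʳ (strictlyInverseˡ _))
       (trans (assoc _ _ _) (trans (∙-congˡ (inverseʳ _)) (identityʳ _))))) (strictlyInverseʳ b))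

module Moves {g ℓ} (G : Group g ℓ) {q : ℕ} (order : HasOrder G q) (m : ℕ) where
  open Multiplication G order public

  Index : Set
  Index = Fin (q ℕ.^ m)

  coord : Index → Fin m → Fin q
  coord = finToFun {q} {m}

  -- For fixed i the indices move i a k run through the part of Qᵢ that contains k; as in the
  -- paper, 0 stands for Q₀, so that Defs.Q i is the partition number suc i.
  move : Fin (suc m) → Fin q → Index → Index
  move zero    a k = funToFin (λ j → a ⊙ coord k j)
  move (suc i) a k = funToFin (updateAt (coord k) i (const a))

  coord-move₀ : ∀ a k j → coord (move zero a k) j ≡ a ⊙ coord k j
  coord-move₀ a k = finToFun-funToFin (λ j → a ⊙ coord k j)

  coord-move≡ : ∀ i a k → coord (move (suc i) a k) i ≡ a
  coord-move≡ i a k = ≡.trans (finToFun-funToFin _ i) (updateAt-updates i (coord k))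

  coord-move≢ : ∀ {i j} a k → j ≢ i → coord (move (suc i) a k) j ≡ coord k j
  coord-move≢ {i} {j} a k j≢i = ≡.trans (finToFun-funToFin _ j) (updateAt-minimal j i (coord k) j≢i)

  coord-ext : ∀ i {k l} → coord k i ≡ coord l i → (∀ j → j ≢ i → coord k j ≡ coord l j) → k ≡ l
  coord-ext i {k} {l} at off = finToFun-injective {m} {q} λ j → agree j
    where
    agree : ∀ j → coord k j ≡ coord l j
    agree j with j Fin.≟ i
    ... | yes ≡.refl = at
    ... | no j≢i = off j j≢i

  move-e : ∀ k → move zero e k ≡ k
  move-e k = finToFun-injective {m} {q} λ j → ≡.trans (coord-move₀ e k j) (e-⊙ _)

  move-coord : ∀ i {a} k → coord k i ≡ a → move (suc i) a k ≡ k
  move-coord i {a} k p = coord-ext i (≡.trans (coord-move≡ i a k) (≡.sym p)) (λ j j≢i → coord-move≢ a k j≢i)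

  move₀-move₀ : ∀ a b k → move zero b (move zero a k) ≡ move zero (b ⊙ a) k
  move₀-move₀ a b k = finToFun-injective {m} {q} λ j → begin
    coord (move zero b (move zero a k)) j   ≡⟨ coord-move₀ b _ j ⟩
    b ⊙ coord (move zero a k) j             ≡⟨ ≡.cong (b ⊙_) (coord-move₀ a k j) ⟩
    b ⊙ a ⊙ coord k j                       ≡⟨ ⊙-assoc b a _ ⟨
    (b ⊙ a) ⊙ coord k j                     ≡⟨ coord-move₀ (b ⊙ a) k j ⟨
    coord (move zero (b ⊙ a) k) j           ∎
    where open ≡.≡-Reasoning

  move-overwrite : ∀ i a b k → move (suc i) b (move (suc i) a k) ≡ move (suc i) b k
  move-overwrite i a b k = coord-ext i
    (≡.trans (coord-move≡ i b _) (≡.sym (coord-move≡ i b k)))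
    (λ j j≢i → ≡.trans (coord-move≢ b _ j≢i) (≡.trans (coord-move≢ a k j≢i) (≡.sym (coord-move≢ b k j≢i))))

  move-commute : ∀ {i j} → i ≢ j → ∀ a b k → move (suc i) a (move (suc j) b k) ≡ move (suc j) b (move (suc i) a k)
  move-commute {i} {j} i≢j a b k = finToFun-injective {m} {q} agree
    where
    agree : ∀ r → coord (move (suc i) a (move (suc j) b k)) r ≡ coord (move (suc j) b (move (suc i) a k)) r
    agree r with r Fin.≟ i | r Fin.≟ j
    ... | yes ≡.refl | yes ≡.refl = ⊥-elim (i≢j ≡.refl)
    ... | yes ≡.refl | no r≢j = ≡.trans (coord-move≡ r a _) (≡.sym (≡.trans (coord-move≢ b _ r≢j) (coord-move≡ r a k)))
    ... | no r≢i | yes ≡.refl = ≡.trans (coord-move≢ a _ r≢i) (≡.trans (coord-move≡ r b k) (≡.sym (coord-move≡ r b _)))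
    ... | no r≢i | no r≢j =
      ≡.trans (coord-move≢ a _ r≢i) (≡.trans (coord-move≢ b k r≢j)
        (≡.sym (≡.trans (coord-move≢ b _ r≢j) (coord-move≢ a k r≢i))))

  -- The moves commute up to the substitution of `t ⊙ a` for `a`, which a sum over all `a` does not
  -- see.
  move₀-move : ∀ i t a k → move zero t (move (suc i) a k) ≡ move (suc i) (t ⊙ a) (move zero t k)
  move₀-move i t a k = coord-ext i
    (≡.trans (coord-move₀ t _ i) (≡.trans (≡.cong (t ⊙_) (coord-move≡ i a k)) (≡.sym (coord-move≡ i (t ⊙ a) _))))
    (λ j j≢i → ≡.trans (coord-move₀ t _ j) (≡.trans (≡.cong (t ⊙_) (coord-move≢ a k j≢i))
      (≡.sym (≡.trans (coord-move≢ (t ⊙ a) _ j≢i) (coord-move₀ t k j)))))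

  module _ (2≤m : 2 ≤ m) where

    private
      some : Fin m
      some = Fin.fromℕ< (ℕ.≤-trans (s≤s z≤n) 2≤m)

    move-injective : ∀ i {a b} k → move i a k ≡ move i b k → a ≡ b
    move-injective zero {a} {b} k p = ⊙-cancelʳ (coord k some)
      (≡.trans (≡.sym (coord-move₀ a k some)) (≡.trans (≡.cong (λ l → coord l some) p) (coord-move₀ b k some)))
    move-injective (suc i) {a} {b} k p =
      ≡.trans (≡.sym (coord-move≡ i a k)) (≡.trans (≡.cong (λ l → coord l i) p) (coord-move≡ i b k))

    move-trivial : ∀ i k → ∃[ a ] move i a k ≡ k
    move-trivial zero    k = e , move-e k
    move-trivial (suc i) k = coord k i , move-coord i k ≡.refl

    -- A translation that changes at most coordinate j fixes another coordinate, hence is trivial.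
    -- If changes of different coordinates i and j lead to the same point, coordinate i has kept its
    -- value.
    move-disjoint : ∀ i j {a b} k → i ≢ j → move i a k ≡ move j b k → move i a k ≡ k
    move-disjoint zero zero k 0≢0 p = ⊥-elim (0≢0 ≡.refl)
    move-disjoint zero (suc j) {a} {b} k _ p with r , r≢j ← another 2≤m j = begin
      move zero a k ≡⟨ ≡.cong (λ t → move zero t k) (⊙-fixes⇒e (coord k r) (begin
        a ⊙ coord k r                ≡⟨ coord-move₀ a k r ⟨
        coord (move zero a k) r      ≡⟨ ≡.cong (λ l → coord l r) p ⟩
        coord (move (suc j) b k) r   ≡⟨ coord-move≢ b k r≢j ⟩
        coord k r                    ∎)) ⟩
      move zero e k ≡⟨ move-e k ⟩
      k             ∎
      where open ≡.≡-Reasoning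
    move-disjoint (suc i) zero k i≢0 p = ≡.trans p (move-disjoint zero (suc i) k (i≢0 ∘ ≡.sym) (≡.sym p))
    move-disjoint (suc i) (suc j) {a} {b} k i≢j p = move-coord i k
      (≡.sym (≡.trans (≡.sym (coord-move≡ i a k)) (≡.trans (≡.cong (λ l → coord l i) p)
        (coord-move≢ b k (i≢j ∘ ≡.cong suc)))))

  open Group G using (_≈_; _∙_; sym; trans; ∙-congʳ; reflexive)
  open Inverse order using (to; from; to-cong; strictlyInverseˡ)
  open Diagonal G m using (_~_; Q₀; Q; Ω-enumeration)

  point : Index → Diagonal.Point G m
  point = Inverse.to (Ω-enumeration order)

  ~⇒move : ∀ {k l} → point k ~ point l → k ≢ l × ∃[ i ] ∃[ a ] move i a k ≡ l
  ~⇒move {k} {l} (k≉l , parts) = (λ { ≡.refl → k≉l (λ _ → Group.refl G) }) , moves parts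
    where
    moves : Q₀ (point k) (point l) ⊎ ∃[ i ] Q i (point k) (point l) → ∃[ i ] ∃[ a ] move i a k ≡ l
    moves (inj₁ (t , p)) = zero , from t , finToFun-injective {m} {q} λ j →
      ≡.trans (coord-move₀ (from t) k j) (to-injective
        (trans (to-⊙ _ _) (trans (∙-congʳ (strictlyInverseˡ t)) (sym (p j)))))
    moves (inj₂ (i , p)) = suc i , coord l i , coord-ext i (coord-move≡ i _ k)
      (λ j j≢i → ≡.trans (coord-move≢ _ k j≢i) (to-injective (p j j≢i)))

  move⇒~ : ∀ {k l} i a → k ≢ l → move i a k ≡ l → point k ~ point l
  move⇒~ {k} i a k≢l ≡.refl = (λ k≋l → k≢l (finToFun-injective {m} {q} λ j → to-injective (k≋l j))) , part i
    where
    part : ∀ i → Q₀ (point k) (point (move i a k)) ⊎ ∃[ j ] Q j (point k) (point (move i a k))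
    part zero = inj₁ (to a , λ j → trans (to-cong (coord-move₀ a k j)) (to-⊙ a _))
    part (suc i) = inj₂ (i , λ j j≢i → to-cong (≡.sym (coord-move≢ a k j≢i)))

-- Averaging operators, the adjacency matrix and the traces.

module DiagonalOperators {c ℓ₁ ℓ₂ g ℓ} (F : HeytingField c ℓ₁ ℓ₂) (G : Group g ℓ) {q : ℕ}
                         (order : HasOrder G q) (m : ℕ) (2≤m : 2 ≤ m)
                         (q⁻¹ : HeytingField.Carrier F)
                         (q⁻¹*q≈1 : HeytingField._≈_ F (HeytingField._*_ F q⁻¹ (Matrices.⟦_⟧ F q)) (HeytingField.1# F))
                         where
  open FieldProperties F
  open LinearOperators F
  open SpectralTheory F
  open Moves G order m
  open Diagonal G m using (_~_)
  open CommutativeRing commutativeRing using (*-commutativeMonoid)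
  open Algebra.Properties.CommutativeMonoid.Sum *-commutativeMonoid
    using () renaming (sum to ∏; sum-remove to ∏-remove; sum-cong-≋ to ∏-cong)

  N : ℕ
  N = q ^ m

  partSum : Fin (suc m) → Operator N
  partSum i v k = sum λ a → v (move i a k)

  average : Fin (suc m) → Operator N
  average i v = q⁻¹ · partSum i v

  partSum-linear : ∀ i → Linear (partSum i)
  partSum-linear i = sum-linear {N} {q} λ a → record
    { congruent = λ v≋w k → v≋w (move i a k) ; linear = λ _ _ _ _ → refl }

  average-linear : ∀ i → Linear (average i)
  average-linear i = ·-linear q⁻¹ (partSum-linear i)

  mean-const : ∀ x → q⁻¹ * sum {q} (λ _ → x) ≈ x
  mean-const x = begin
    q⁻¹ * sum {q} (λ _ → x)   ≈⟨ *-congˡ (sum-const q x) ⟩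
    q⁻¹ * (⟦ q ⟧ * x)         ≈⟨ *-assoc _ _ _ ⟨
    q⁻¹ * ⟦ q ⟧ * x           ≈⟨ *-congʳ q⁻¹*q≈1 ⟩
    1# * x                    ≈⟨ *-identityˡ x ⟩
    x                         ∎

  partSum-move : ∀ i a v k → partSum i v (move i a k) ≈ partSum i v k
  partSum-move zero a v k = begin
    sum (λ b → v (move zero b (move zero a k)))   ≡⟨ sum-cong-≗ {q} (λ b → ≡.cong v (move₀-move₀ a b k)) ⟩
    sum (λ b → v (move zero (b ⊙ a) k))           ≈⟨ sum-permute {q} {q} (λ b → v (move zero b k)) (right a) ⟨
    sum (λ b → v (move zero b k))                 ∎
  partSum-move (suc i) a v k = sum-cong-≋ {q} (λ b → reflexive (≡.cong v (move-overwrite i a b k)))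

  average-idempotent : ∀ i v → average i (average i v) ≋ average i v
  average-idempotent i v k = begin
    q⁻¹ * sum (λ a → q⁻¹ * partSum i v (move i a k))
      ≈⟨ *-congˡ (sum-cong-≋ {q} (λ a → *-congˡ (partSum-move i a v k))) ⟩
    q⁻¹ * sum {q} (λ _ → q⁻¹ * partSum i v k)     ≈⟨ mean-const _ ⟩
    q⁻¹ * partSum i v k                           ∎

  private
    partSum₀-commuting : ∀ i → Commuting (partSum zero) (partSum (suc i))
    partSum₀-commuting i v k = begin
      sum (λ t → sum (λ a → v (move (suc i) a (move zero t k))))
        ≈⟨ sum-cong-≋ {q} (λ t → sum-permute {q} {q} (λ a → v (move (suc i) a (move zero t k))) (left t)) ⟩
      sum (λ t → sum (λ a → v (move (suc i) (t ⊙ a) (move zero t k))))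
        ≈⟨ sum-cong-≋ {q} (λ t → sum-cong-≋ {q} (λ a → reflexive (≡.cong v (move₀-move i t a k)))) ⟨
      sum (λ t → sum (λ a → v (move zero t (move (suc i) a k))))
        ≈⟨ ∑-comm {q} {q} (λ t a → v (move zero t (move (suc i) a k))) ⟩
      sum (λ a → sum (λ t → v (move zero t (move (suc i) a k)))) ∎

  partSum-commuting : ∀ i j → Commuting (partSum i) (partSum j)
  partSum-commuting zero zero v k = refl
  partSum-commuting zero (suc j) v k = partSum₀-commuting j v k
  partSum-commuting (suc i) zero v k = sym (partSum₀-commuting i v k)
  partSum-commuting (suc i) (suc j) v k with i Fin.≟ j
  ... | yes ≡.refl = refl
  ... | no i≢j = begin
    sum (λ a → sum (λ b → v (move (suc j) b (move (suc i) a k))))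
      ≈⟨ ∑-comm {q} {q} (λ a b → v (move (suc j) b (move (suc i) a k))) ⟩
    sum (λ b → sum (λ a → v (move (suc j) b (move (suc i) a k))))
      ≈⟨ sum-cong-≋ {q} (λ b → sum-cong-≋ {q} (λ a → reflexive (≡.cong v (move-commute i≢j a b k)))) ⟨
    sum (λ b → sum (λ a → v (move (suc i) a (move (suc j) b k)))) ∎

  average-commuting : ∀ i j → Commuting (average i) (average j)
  average-commuting i j v k = *-congˡ (begin
    partSum i (q⁻¹ · partSum j v) k       ≈⟨ ·-homo (partSum-linear i) q⁻¹ (partSum j v) k ⟩
    q⁻¹ * partSum i (partSum j v) k       ≈⟨ *-congˡ (partSum-commuting i j v k) ⟩
    q⁻¹ * partSum j (partSum i v) k       ≈⟨ ·-homo (partSum-linear j) q⁻¹ (partSum i v) k ⟨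
    partSum j (q⁻¹ · partSum i v) k       ∎)

  averages : CommutingIdempotents average
  averages = record
    { linears    = average-linear
    ; idempotent = average-idempotent
    ; commuting  = average-commuting
    }

  A : SquareMatrix N
  A = diagonalMatrix F G order m

  part-hit : ∀ i {a} k l → move i a k ≡ l → sum (λ b → δ l (move i b k)) ≈ 1#
  part-hit i {a} k l ≡.refl = trans
    (sum-single a _ (λ b b≢a → reflexive (δ-off-diagonal (λ p → b≢a (move-injective 2≤m i k p)))))
    (reflexive (δ-diagonal (move i a k)))

  part-miss : ∀ i k l → (∀ a → move i a k ≢ l) → sum (λ b → δ l (move i b k)) ≈ 0#
  part-miss i k l miss = sum-zero {q} (λ b → reflexive (δ-off-diagonal (miss b)))

  A-adjacent : ∀ {k l} → point k ~ point l → A k l ≡ 1#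
  A-adjacent {k} {l} k~l =
    ≡.cong (λ b → if b then 1# else 0#) (dec-true (Diagonal._~?_ G m order (point k) (point l)) k~l)

  A-nonadjacent : ∀ {k l} → ¬ (point k ~ point l) → A k l ≡ 0#
  A-nonadjacent {k} {l} k≁l =
    ≡.cong (λ b → if b then 1# else 0#) (dec-false (Diagonal._~?_ G m order (point k) (point l)) k≁l)

  adjacency-entry : ∀ k l → A k l + ⟦ suc m ⟧ * δ l k ≈ matrix (total partSum) k l
  adjacency-entry k l with k Fin.≟ l | Diagonal._~?_ G m order (point k) (point l)
  ... | yes ≡.refl | yes k~k = ⊥-elim (proj₁ (~⇒move k~k) ≡.refl)
  ... | yes ≡.refl | no k≁k = begin
    A k k + ⟦ suc m ⟧ * 1#       ≈⟨ +-congʳ (reflexive (A-nonadjacent k≁k)) ⟩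
    0# + ⟦ suc m ⟧ * 1#          ≈⟨ trans (+-identityˡ _) (*-identityʳ _) ⟩
    ⟦ suc m ⟧                    ≈⟨ sum-1 (suc m) ⟨
    -- Every partition has a part through `k`, so each of the m + 1 sums contributes 1 to the
    -- diagonal.
    sum {suc m} (λ _ → 1#)       ≈⟨ sum-cong-≋ {suc m} (λ i → part-hit i k k (proj₂ (move-trivial 2≤m i k))) ⟨
    matrix (total partSum) k k   ∎
  ... | no k≢l | yes k~l with _ , i , a , hit ← ~⇒move k~l = begin
    A k l + ⟦ suc m ⟧ * 0#       ≈⟨ +-congʳ (reflexive (A-adjacent k~l)) ⟩
    1# + ⟦ suc m ⟧ * 0#          ≈⟨ trans (+-congˡ (zeroʳ _)) (+-identityʳ _) ⟩
    1#                           ≈⟨ part-hit i k l hit ⟨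
    -- A second part containing both points would make them equal, so the other sums vanish.
    sum (λ b → δ l (move i b k)) ≈⟨ sum-single i _ (λ j j≢i → part-miss j k l λ b p →
                                      k≢l (≡.trans (≡.sym (move-disjoint 2≤m j i k j≢i (≡.trans p (≡.sym hit)))) p)) ⟨
    matrix (total partSum) k l   ∎
  ... | no k≢l | no k≁l = begin
    A k l + ⟦ suc m ⟧ * 0#       ≈⟨ +-congʳ (reflexive (A-nonadjacent k≁l)) ⟩
    0# + ⟦ suc m ⟧ * 0#          ≈⟨ trans (+-identityˡ _) (zeroʳ _) ⟩
    0#                           ≈⟨ sum-zero {suc m} (λ i → part-miss i k l λ a p → k≁l (move⇒~ i a k≢l p)) ⟨
    matrix (total partSum) k l   ∎

  adjacency-*ᵥ : ∀ v k → (A *ᵥ v) k + ⟦ suc m ⟧ * v k ≈ ⟦ q ⟧ * total average v k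
  adjacency-*ᵥ v k = begin
    (A *ᵥ v) k + ⟦ suc m ⟧ * v k
      ≈⟨ +-congˡ (*-congˡ (matrix-*ᵥ id-linear v k)) ⟨
    sum (λ l → A k l * v l) + ⟦ suc m ⟧ * sum (λ l → δ l k * v l)
      ≈⟨ sum-+* {N} ⟦ suc m ⟧ (λ l → A k l * v l) (λ l → δ l k * v l) ⟨
    sum (λ l → A k l * v l + ⟦ suc m ⟧ * (δ l k * v l))
      ≈⟨ sum-cong-≋ {N} (λ l → trans
           (solve 4 (λ a m d v → a :* v :+ m :* (d :* v) := (a :+ m :* d) :* v) refl (A k l) ⟦ suc m ⟧ (δ l k) (v l))
           (*-congʳ (adjacency-entry k l))) ⟩
    (matrix (total partSum) *ᵥ v) k
      ≈⟨ matrix-*ᵥ (sum-linear partSum-linear) v k ⟩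
    total partSum v k
      ≈⟨ *-identityˡ _ ⟨
    1# * total partSum v k
      ≈⟨ *-congʳ (trans (*-comm ⟦ q ⟧ q⁻¹) q⁻¹*q≈1) ⟨
    ⟦ q ⟧ * q⁻¹ * total partSum v k
      ≈⟨ *-assoc _ _ _ ⟩
    ⟦ q ⟧ * (q⁻¹ * total partSum v k)
      ≈⟨ *-congˡ (*-distribˡ-sum {suc m} q⁻¹ (λ i → partSum i v k)) ⟩
    ⟦ q ⟧ * total average v k ∎

  -- Pure tensors in the m-fold tensor power of the functions on the group. Averaging over one
  -- coordinate acts on one tensor factor, and the functions `δ k` are of this form.
  separable : (Fin m → Fin q → Carrier) → Vector Carrier N
  separable f k = ∏ λ j → f j (coord k j)

  mean : (Fin q → Carrier) → Carrier
  mean h = q⁻¹ * sum h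

  average-separable : ∀ i f → average (suc i) (separable f) ≋ separable (updateAt f i (λ h → const (mean h)))
  average-separable i f k = mean-∏ i
    (λ a j → f j (coord (move (suc i) a k) j)) (λ j → updateAt f i (λ h → const (mean h)) j (coord k j))
    (trans (reflexive (≡.cong (λ h → h (coord k i)) (updateAt-updates i f)))
      (*-congˡ (sum-cong-≋ {q} (λ a → reflexive (≡.cong (f i) (≡.sym (coord-move≡ i a k)))))))
    (λ a j j≢i → trans (reflexive (≡.cong (f j) (coord-move≢ a k j≢i)))
      (reflexive (≡.sym (≡.cong (λ h → h (coord k j)) (updateAt-minimal j i f j≢i)))))
    where
    mean-∏ : ∀ {m} (i : Fin m) (t : Fin q → Fin m → Carrier) (s : Fin m → Carrier) →
             s i ≈ mean (λ a → t a i) → (∀ a j → j ≢ i → t a j ≈ s j) → mean (λ a → ∏ (t a)) ≈ ∏ s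
    mean-∏ {suc m} i t s sᵢ t≈s = begin
      q⁻¹ * sum (λ a → ∏ (t a))
        ≈⟨ *-congˡ (sum-cong-≋ {q} (λ a → trans (∏-remove {i = i} (t a))
             (*-congˡ (∏-cong {m} (λ j → t≈s a (punchIn i j) (punchInᵢ≢i i j)))))) ⟩
      q⁻¹ * sum (λ a → t a i * ∏ (s ∘ punchIn i))
        ≈⟨ *-congˡ (*-distribʳ-sum {q} _ (λ a → t a i)) ⟨
      q⁻¹ * (sum (λ a → t a i) * ∏ (s ∘ punchIn i))
        ≈⟨ *-assoc _ _ _ ⟨
      mean (λ a → t a i) * ∏ (s ∘ punchIn i)
        ≈⟨ *-congʳ sᵢ ⟨
      s i * ∏ (s ∘ punchIn i)
        ≈⟨ ∏-remove {i = i} s ⟨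
      ∏ s ∎

  -- The coordinates meant by the subset are named through `ι`, because the induction shortens the
  -- subset while m stays fixed; in the end `ι` is the identity.
  smear : ∀ {r} → (Fin r → Fin m) → Subset r → (Fin m → Fin q → Carrier) → Fin m → Fin q → Carrier
  smear ι []            f = f
  smear ι (inside ∷ T)  f = updateAt (smear (ι ∘ suc) T f) (ι zero) (λ h → const (mean h))
  smear ι (outside ∷ T) f = smear (ι ∘ suc) T f

  product-separable : ∀ {r} (ι : Fin r → Fin m) T f →
                      product (λ i → average (suc (ι i))) T (separable f) ≋ separable (smear ι T f)
  product-separable ι []            f k = refl
  product-separable ι (outside ∷ T) f k = product-separable (ι ∘ suc) T f k
  product-separable ι (inside ∷ T)  f k = trans
    (congruent (average-linear (suc (ι zero))) (product-separable (ι ∘ suc) T f) k)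
    (average-separable (ι zero) (smear (ι ∘ suc) T f) k)

  smear-∉ : ∀ {r} (ι : Fin r → Fin m) T f j → (∀ i → j ≢ ι i) → smear ι T f j ≡ f j
  smear-∉ ι [] f j j∉ι = ≡.refl
  smear-∉ ι (outside ∷ T) f j j∉ι = smear-∉ (ι ∘ suc) T f j (j∉ι ∘ suc)
  smear-∉ ι (inside ∷ T) f j j∉ι =
    ≡.trans (updateAt-minimal j (ι zero) _ (j∉ι zero)) (smear-∉ (ι ∘ suc) T f j (j∉ι ∘ suc))

  smear-∈ : ∀ {r} (ι : Fin r → Fin m) → Injective _≡_ _≡_ ι → ∀ T f i →
            smear ι T f (ι i) ≡ (if lookup T i then const (mean (f (ι i))) else f (ι i))
  smear-∈ ι inj (outside ∷ T) f zero = smear-∉ (ι ∘ suc) T f (ι zero) (λ i p → Fin.0≢1+n (inj p))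
  smear-∈ ι inj (outside ∷ T) f (suc i) = smear-∈ (ι ∘ suc) (Fin.suc-injective ∘ inj) T f i
  smear-∈ ι inj (inside ∷ T) f zero = ≡.trans (updateAt-updates (ι zero) _)
    (≡.cong (λ h → const (mean h)) (smear-∉ (ι ∘ suc) T f (ι zero) (λ i p → Fin.0≢1+n (inj p))))
  smear-∈ ι inj (inside ∷ T) f (suc i) =
    ≡.trans (updateAt-minimal (ι (suc i)) (ι zero) _ (λ p → Fin.0≢1+n (≡.sym (inj p))))
            (smear-∈ (ι ∘ suc) (Fin.suc-injective ∘ inj) T f i)

  ∏-ones : ∀ {m} {t : Vector Carrier m} → (∀ j → t j ≈ 1#) → ∏ t ≈ 1#
  ∏-ones {zero} t≈1 = refl
  ∏-ones {suc m} t≈1 = trans (*-cong (t≈1 zero) (∏-ones (t≈1 ∘ suc))) (*-identityˡ 1#)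

  ∏-zero : ∀ {m} {t : Vector Carrier m} j → t j ≈ 0# → ∏ t ≈ 0#
  ∏-zero zero t₀≈0 = trans (*-congʳ t₀≈0) (zeroˡ _)
  ∏-zero (suc j) tⱼ≈0 = trans (*-congˡ (∏-zero j tⱼ≈0)) (zeroʳ _)

  δ-separable : ∀ k → δ k ≋ separable (λ j → δ (coord k j))
  δ-separable k l with l Fin.≟ k
  ... | yes ≡.refl = sym (∏-ones (λ j → reflexive (δ-diagonal (coord l j))))
  ... | no l≢k with j , p ← ¬∀⟶∃¬ m (λ j → coord l j ≡ coord k j) (λ j → coord l j Fin.≟ coord k j)
                               (l≢k ∘ finToFun-injective {m} {q})
    = sym (∏-zero j (reflexive (δ-off-diagonal p)))

  mean-δ : ∀ a → mean (δ a) ≈ q⁻¹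
  mean-δ a = trans (*-congˡ (trans (sum-single a (δ a) (λ b b≢a → reflexive (δ-off-diagonal b≢a)))
                                   (reflexive (δ-diagonal a)))) (*-identityʳ q⁻¹)

  -- The entry of a product of coordinate averages at two points that agree in all coordinates (`y`
  -- is 1) or in none (`y` is 0).
  weight : ∀ {r} → Subset r → Carrier → Carrier
  weight T y = ∏ λ j → if lookup T j then q⁻¹ else y

  product-δ : ∀ T k l → product (average ∘ suc) T (δ k) l ≈
                        ∏ λ j → if lookup T j then q⁻¹ else δ (coord k j) (coord l j)
  product-δ T k l = begin
    product (average ∘ suc) T (δ k) l
      ≈⟨ congruent (product-linear (average-linear ∘ suc) T) (δ-separable k) l ⟩
    product (average ∘ suc) T (separable f) l
      ≈⟨ product-separable id T f l ⟩
    (∏ λ j → smear id T f j (coord l j))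
      ≈⟨ ∏-cong {m} (λ j → trans (reflexive (≡.cong (λ h → h (coord l j)) (smear-∈ id id T f j))) (factor j)) ⟩
    (∏ λ j → if lookup T j then q⁻¹ else δ (coord k j) (coord l j)) ∎
    where
    f : Fin m → Fin q → Carrier
    f j = δ (coord k j)
    product-linear : ∀ {r} {E : Fin r → Operator N} → (∀ i → Linear (E i)) → ∀ T → Linear (product E T)
    product-linear lin []            = id-linear
    product-linear lin (inside ∷ T)  = ∘-linear (lin zero) (product-linear (lin ∘ suc) T)
    product-linear lin (outside ∷ T) = product-linear (lin ∘ suc) T
    factor : ∀ j → (if lookup T j then const (mean (f j)) else f j) (coord l j) ≈
                   (if lookup T j then q⁻¹ else f j (coord l j))
    factor j with lookup T j
    ... | inside = mean-δ (coord k j)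
    ... | outside = refl

  cancel-q : ∀ x → ⟦ q ⟧ * (q⁻¹ * x) ≈ x
  cancel-q x = begin
    ⟦ q ⟧ * (q⁻¹ * x)    ≈⟨ solve 3 (λ q c x → q :* (c :* x) := c :* q :* x) refl ⟦ q ⟧ q⁻¹ x ⟩
    q⁻¹ * ⟦ q ⟧ * x      ≈⟨ *-congʳ q⁻¹*q≈1 ⟩
    1# * x               ≈⟨ *-identityˡ x ⟩
    x                    ∎

  weight-one : ∀ {r} (T : Subset r) → ⟦ q ^ r ⟧ * weight T 1# ≈ ⟦ q ^ (r ∸ ∣ T ∣) ⟧
  weight-one [] = *-identityʳ _
  weight-one {suc r} (inside ∷ T) = begin
    ⟦ q ℕ.* q ^ r ⟧ * (q⁻¹ * weight T 1#)       ≈⟨ *-congʳ (×1-homo-* q (q ^ r)) ⟩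
    ⟦ q ⟧ * ⟦ q ^ r ⟧ * (q⁻¹ * weight T 1#)
      ≈⟨ solve 4 (λ q Q c w → q :* Q :* (c :* w) := q :* (c :* (Q :* w))) refl ⟦ q ⟧ ⟦ q ^ r ⟧ q⁻¹ (weight T 1#) ⟩
    ⟦ q ⟧ * (q⁻¹ * (⟦ q ^ r ⟧ * weight T 1#))   ≈⟨ cancel-q _ ⟩
    ⟦ q ^ r ⟧ * weight T 1#                     ≈⟨ weight-one T ⟩
    ⟦ q ^ (r ∸ ∣ T ∣) ⟧                         ∎
  weight-one {suc r} (outside ∷ T) = begin
    ⟦ q ℕ.* q ^ r ⟧ * (1# * weight T 1#)        ≈⟨ *-cong (×1-homo-* q (q ^ r)) (*-identityˡ _) ⟩
    ⟦ q ⟧ * ⟦ q ^ r ⟧ * weight T 1#             ≈⟨ *-assoc _ _ _ ⟩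
    ⟦ q ⟧ * (⟦ q ^ r ⟧ * weight T 1#)           ≈⟨ *-congˡ (weight-one T) ⟩
    ⟦ q ⟧ * ⟦ q ^ (r ∸ ∣ T ∣) ⟧                 ≈⟨ ×1-homo-* q _ ⟨
    ⟦ q ^ suc (r ∸ ∣ T ∣) ⟧                     ≡⟨ ≡.cong (λ j → ⟦ q ^ j ⟧) (ℕ.+-∸-assoc 1 (∣p∣≤n T)) ⟨
    ⟦ q ^ (suc r ∸ ∣ T ∣) ⟧                     ∎

  -- A subset that is not full leaves a factor `y`. With Q₀ included, this dichotomy separates the
  -- product of all averages from the others.
  weight-full⊎zero : ∀ {r} (T : Subset r) →
    (∣ T ∣ ≡ r × (∀ y → weight T y ≈ weight T 1#)) ⊎ (∣ T ∣ < r × weight T 0# ≈ 0#)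
  weight-full⊎zero [] = inj₁ (≡.refl , λ _ → refl)
  weight-full⊎zero (outside ∷ T) = inj₂ (s≤s (∣p∣≤n T) , zeroˡ _)
  weight-full⊎zero (inside ∷ T) with weight-full⊎zero T
  ... | inj₁ (full , const-y) = inj₁ (≡.cong suc full , λ y → *-congˡ (const-y y))
  ... | inj₂ (∣T∣<r , w≈0) = inj₂ (s≤s ∣T∣<r , trans (*-congˡ w≈0) (zeroʳ _))

  -- A translation other than the identity moves every coordinate, so unless `T` is full only
  -- `t ≡ e` contributes and the mean costs a factor `q⁻¹`. For full `T` all translations contribute
  -- alike, and the truncated exponent `m ∸ suc m` gives the trace 1.
  mean-weight : ∀ T → ⟦ N ⟧ * mean (λ t → weight T (δ e t)) ≈ ⟦ q ^ (m ∸ suc ∣ T ∣) ⟧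
  mean-weight T with weight-full⊎zero T
  ... | inj₁ (∣T∣≡m , const-y) = begin
    ⟦ N ⟧ * mean (λ t → weight T (δ e t))
      ≈⟨ *-congˡ (trans (*-congˡ (sum-cong-≋ {q} (λ t → const-y (δ e t)))) (mean-const _)) ⟩
    ⟦ N ⟧ * weight T 1#         ≈⟨ weight-one T ⟩
    ⟦ q ^ (m ∸ ∣ T ∣) ⟧         ≡⟨ ≡.cong (λ j → ⟦ q ^ j ⟧) (≡.trans (ℕ.m≤n⇒m∸n≡0 m≤∣T∣)
                                     (≡.sym (ℕ.m≤n⇒m∸n≡0 (ℕ.m≤n⇒m≤1+n m≤∣T∣)))) ⟩
    ⟦ q ^ (m ∸ suc ∣ T ∣) ⟧     ∎
    where m≤∣T∣ = ℕ.≤-reflexive (≡.sym ∣T∣≡m)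
  ... | inj₂ (∣T∣<m , w≈0) = begin
    ⟦ N ⟧ * mean (λ t → weight T (δ e t))
      ≈⟨ *-congˡ (*-congˡ (trans
           (sum-single e _ (λ t t≢e → trans (reflexive (≡.cong (weight T) (δ-off-diagonal t≢e))) w≈0))
           (reflexive (≡.cong (weight T) (δ-diagonal e))))) ⟩
    ⟦ N ⟧ * (q⁻¹ * weight T 1#)
      ≈⟨ solve 3 (λ N c w → N :* (c :* w) := c :* (N :* w)) refl ⟦ N ⟧ q⁻¹ (weight T 1#) ⟩
    q⁻¹ * (⟦ N ⟧ * weight T 1#)                ≈⟨ *-congˡ (weight-one T) ⟩
    q⁻¹ * ⟦ q ^ (m ∸ ∣ T ∣) ⟧                  ≡⟨ ≡.cong (λ j → q⁻¹ * ⟦ q ^ j ⟧) (ℕ.+-∸-assoc 1 ∣T∣<m) ⟩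
    q⁻¹ * ⟦ q ℕ.* q ^ (m ∸ suc ∣ T ∣) ⟧        ≈⟨ *-congˡ (×1-homo-* q _) ⟩
    q⁻¹ * (⟦ q ⟧ * ⟦ q ^ (m ∸ suc ∣ T ∣) ⟧)    ≈⟨ solve 3 (λ c q x → c :* (q :* x) := q :* (c :* x)) refl q⁻¹ ⟦ q ⟧ _ ⟩
    ⟦ q ⟧ * (q⁻¹ * ⟦ q ^ (m ∸ suc ∣ T ∣) ⟧)    ≈⟨ cancel-q _ ⟩
    ⟦ q ^ (m ∸ suc ∣ T ∣) ⟧                    ∎

  δ-⊙ : ∀ x t → δ x (t ⊙ x) ≡ δ e t
  δ-⊙ x t with t Fin.≟ e
  ... | yes ≡.refl = ≡.trans (≡.cong (δ x) (e-⊙ x)) (δ-diagonal x)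
  ... | no t≢e = δ-off-diagonal (t≢e ∘ ⊙-fixes⇒e x)

  -- All diagonal entries of the product are equal, so the trace is `N` times one of them. The head
  -- of `T` tells whether the average over Q₀ takes part; if so, an entry is itself a mean over
  -- translations.
  tr-product : ∀ T → tr (product average T) ≈ ⟦ q ^ (m ∸ ∣ T ∣) ⟧
  tr-product (outside ∷ T) = begin
    sum (λ k → product (average ∘ suc) T (δ k) k)
      ≈⟨ sum-cong-≋ {N} (λ k → trans (product-δ T k k) (∏-cong {m} (λ j → reflexive
           (≡.cong (λ y → if lookup T j then q⁻¹ else y) (δ-diagonal (coord k j)))))) ⟩
    sum {N} (λ _ → weight T 1#)      ≈⟨ sum-const N _ ⟩
    ⟦ N ⟧ * weight T 1#              ≈⟨ weight-one T ⟩
    ⟦ q ^ (m ∸ ∣ T ∣) ⟧              ∎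
  tr-product (inside ∷ T) = begin
    sum (λ k → mean (λ t → product (average ∘ suc) T (δ k) (move zero t k)))
      ≈⟨ sum-cong-≋ {N} (λ k → *-congˡ (sum-cong-≋ {q} (λ t → trans (product-δ T k (move zero t k))
           (∏-cong {m} (λ j → reflexive (≡.cong (λ y → if lookup T j then q⁻¹ else y)
             (≡.trans (≡.cong (δ (coord k j)) (coord-move₀ t k j)) (δ-⊙ (coord k j) t)))))))) ⟩
    sum {N} (λ _ → mean (λ t → weight T (δ e t)))     ≈⟨ sum-const N _ ⟩
    ⟦ N ⟧ * mean (λ t → weight T (δ e t))             ≈⟨ mean-weight T ⟩
    ⟦ q ^ (m ∸ suc ∣ T ∣) ⟧                           ∎

-- The spectrum of the diagonal graph.

n/1≡0⇒n≡0 : ∀ {n} → (+ n) / 1 ≡ 0ℚ → n ≡ 0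
n/1≡0⇒n≡0 {n} p with ℚᵘ.≃-trans (ℚᵘ.≃-sym (ℚ.toℚᵘ-fromℚᵘ (ℚᵘ.mkℚᵘ (+ n) 0))) (ℚᵘ.≃-reflexive (≡.cong toℚᵘ p))
... | ℚᵘ.*≡* eq = ℤ.+-injective (≡.trans (≡.sym (ℤ.*-identityʳ (+ n))) eq)

module Spectrum {c ℓ₁ ℓ₂ g ℓ} (F : HeytingField c ℓ₁ ℓ₂) (char0 : Matrices.CharacteristicZero F)
                (m : ℕ) (2≤m : 2 ≤ m) (G : Group g ℓ) (p : ℕ) (order : HasOrder G (suc p)) where
  open FieldProperties F
  open LinearOperators F using (tr)
  open SpectralTheory F using (component; total)
  open EigenspaceDimensions F char0

  q : ℕ
  q = suc p

  open DiagonalOperators F G order m 2≤m (proj₁ (#0⇒inverse (char0 p))) (proj₂ (#0⇒inverse (char0 p)))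

  module _ {μ ν} (μ≈ : μ ≈ - ⟦ suc m ⟧ + ν * ⟦ q ⟧) where

    eigenspace⇒total : ∀ {v} → Eigenspace A μ v → total average v ≋ ν · v
    eigenspace⇒total {v} eig k = *-cancelˡ-#0 (char0 p) (begin
      ⟦ q ⟧ * total average v k                            ≈⟨ adjacency-*ᵥ v k ⟨
      (A *ᵥ v) k + ⟦ suc m ⟧ * v k                         ≈⟨ +-congʳ (trans (eig k) (*-congʳ μ≈)) ⟩
      (- ⟦ suc m ⟧ + ν * ⟦ q ⟧) * v k + ⟦ suc m ⟧ * v k
        ≈⟨ solve 4 (λ M ν q v → (:- M :+ ν :* q) :* v :+ M :* v := q :* (ν :* v)) refl ⟦ suc m ⟧ ν ⟦ q ⟧ (v k) ⟩
      ⟦ q ⟧ * (ν * v k)                                    ∎)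

    total⇒eigenspace : ∀ {v} → total average v ≋ ν · v → Eigenspace A μ v
    total⇒eigenspace {v} eig k = begin
      (A *ᵥ v) k
        ≈⟨ solve 2 (λ a b → a := a :+ b :- b) refl ((A *ᵥ v) k) (⟦ suc m ⟧ * v k) ⟩
      (A *ᵥ v) k + ⟦ suc m ⟧ * v k - ⟦ suc m ⟧ * v k       ≈⟨ +-congʳ (adjacency-*ᵥ v k) ⟩
      ⟦ q ⟧ * total average v k - ⟦ suc m ⟧ * v k          ≈⟨ +-congʳ (*-congˡ (eig k)) ⟩
      ⟦ q ⟧ * (ν * v k) - ⟦ suc m ⟧ * v k
        ≈⟨ solve 4 (λ M ν q v → q :* (ν :* v) :- M :* v := (:- M :+ ν :* q) :* v) refl ⟦ suc m ⟧ ν ⟦ q ⟧ (v k) ⟩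
      (- ⟦ suc m ⟧ + ν * ⟦ q ⟧) * v k                      ≈⟨ *-congʳ μ≈ ⟨
      μ * v k                                              ∎

  eigenvalue : ℕ → Carrier
  eigenvalue k = - ⟦ suc m ⟧ + ⟦ k ⟧ * ⟦ q ⟧

  principal : Carrier
  principal = ⟦ suc m ⟧ * (⟦ q ⟧ - 1#)

  principal≈ : principal ≈ eigenvalue (suc m)
  principal≈ = begin
    ⟦ suc m ⟧ * (⟦ q ⟧ - 1#)
      ≈⟨ solve 3 (λ M q o → M :* (q :- o) := :- (M :* o) :+ M :* q) refl ⟦ suc m ⟧ ⟦ q ⟧ 1# ⟩
    - (⟦ suc m ⟧ * 1#) + ⟦ suc m ⟧ * ⟦ q ⟧     ≈⟨ +-congʳ (-‿cong (*-identityʳ _)) ⟩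
    - ⟦ suc m ⟧ + ⟦ suc m ⟧ * ⟦ q ⟧            ∎

  hasMultiplicity : ∀ {μ k d} → k ≤ suc m → tr (component average k) ≈ ⟦ d ⟧ → μ ≈ eigenvalue k → HasMultiplicity A μ d
  hasMultiplicity k≤1+m tr≈d μ≈ =
    hasDimension-resp-⇔ (total⇒eigenspace μ≈) (eigenspace⇒total μ≈) (dimension-eigenspace averages k≤1+m tr≈d)

  dim : ℕ → ℕ
  dim k = (suc m C k) ℕ.* cycleDim p (m ∸ k)

  hasMultiplicity-≤ : ∀ {μ k} → k ≤ m → μ ≈ eigenvalue k → HasMultiplicity A μ (dim k)
  hasMultiplicity-≤ k≤m = hasMultiplicity (ℕ.m≤n⇒m≤1+n k≤m) (tr-component-≤ m p average-linear tr-product k≤m)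

  hasMultiplicity-principal : ∀ {μ} → μ ≈ principal → HasMultiplicity A μ 1
  hasMultiplicity-principal μ≈ =
    hasMultiplicity ℕ.≤-refl (tr-component-top m p average-linear tr-product) (trans μ≈ principal≈)

  -- This form of an arbitrary `μ` turns its eigenvectors into eigenvectors of the sum of the
  -- averages, whose eigenvalues are classified.
  rescale : ∀ μ → μ ≈ - ⟦ suc m ⟧ + proj₁ (#0⇒inverse (char0 p)) * (μ + ⟦ suc m ⟧) * ⟦ q ⟧
  rescale μ = begin
    μ                                              ≈⟨ solve 2 (λ μ M → μ := :- M :+ (μ :+ M)) refl μ ⟦ suc m ⟧ ⟩
    - ⟦ suc m ⟧ + (μ + ⟦ suc m ⟧)                  ≈⟨ +-congˡ (cancel-q _) ⟨
    - ⟦ suc m ⟧ + ⟦ q ⟧ * (q⁻¹ * (μ + ⟦ suc m ⟧))  ≈⟨ +-congˡ (*-comm _ _) ⟩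
    - ⟦ suc m ⟧ + q⁻¹ * (μ + ⟦ suc m ⟧) * ⟦ q ⟧    ∎
    where q⁻¹ = proj₁ (#0⇒inverse (char0 p))

  InSpectrum : Carrier → Set ℓ₁
  InSpectrum μ = (∃[ k ] k < m × multiplicity m k q ≢ 0ℚ × μ ≈ eigenvalue k) ⊎ μ ≈ principal

  classify : ∀ {μ} k → k ≤ suc m → (k ≤ m → dim k ≢ 0) → μ ≈ eigenvalue k → InSpectrum μ
  classify k k≤1+m dim≢0 μ≈ with k ℕ.≟ suc m | k ℕ.≟ m
  ... | yes ≡.refl | _ = inj₂ (trans μ≈ (sym principal≈))
  -- At k = m the dimension has the factor `cycleDim p 0`, which is 0, so this value is excluded and
  -- the list ends at m - 1.
  ... | no _ | yes ≡.refl = ⊥-elim (dim≢0 ℕ.≤-refl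
    (≡.trans (≡.cong (λ j → (suc m C m) ℕ.* cycleDim p j) (ℕ.n∸n≡0 m)) (ℕ.*-zeroʳ (suc m C m))))
  ... | no k≢1+m | no k≢m = inj₁ (k , k<m
    , (λ mult≡0 → dim≢0 (ℕ.<⇒≤ k<m) (n/1≡0⇒n≡0 (≡.trans (multiplicity-closed m k p) mult≡0)))
    , μ≈)
    where k<m = ℕ.≤∧≢⇒< (s≤s⁻¹ (ℕ.≤∧≢⇒< k≤1+m k≢1+m)) k≢m

  isEigenvalue⇒ : ∀ μ → IsEigenvalue A μ → InSpectrum μ
  isEigenvalue⇒ μ (v , v≉𝟎 , eig) =
    conclude (total-eigenvalue averages v≉𝟎 (eigenspace⇒total (rescale μ) eig))
    where
    conclude : ∃[ k ] k ≤ suc m × _ ≈ ⟦ k ⟧ → InSpectrum μ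
    conclude (k , k≤1+m , ν≈k) = classify k k≤1+m dim≢0 μ≈
      where
      μ≈ : μ ≈ eigenvalue k
      μ≈ = trans (rescale μ) (+-congˡ (*-congʳ ν≈k))
      dim≢0 : k ≤ m → dim k ≢ 0
      dim≢0 k≤m dim≡0 = v≉𝟎 (dimension-zero⇒vanishes
        (≡.subst (HasMultiplicity A μ) dim≡0 (hasMultiplicity-≤ k≤m μ≈)) eig)

  hasMultiplicity⇒isEigenvalue : ∀ {μ} d → d ≢ 0 → HasMultiplicity A μ d → IsEigenvalue A μ
  hasMultiplicity⇒isEigenvalue zero    0≢0 _      = ⊥-elim (0≢0 ≡.refl)
  hasMultiplicity⇒isEigenvalue (suc d) _   hasDim = dimension-suc⇒nonzero hasDim

  isEigenvalue⇐ : ∀ μ → InSpectrum μ → IsEigenvalue A μ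
  isEigenvalue⇐ μ (inj₁ (k , k<m , mult≢0 , μ≈)) = hasMultiplicity⇒isEigenvalue (dim k)
    (λ dim≡0 → mult≢0 (≡.trans (≡.sym (multiplicity-closed m k p)) (≡.cong (λ d → (+ d) / 1) dim≡0)))
    (hasMultiplicity-≤ (ℕ.<⇒≤ k<m) μ≈)
  isEigenvalue⇐ μ (inj₂ μ≈) = hasMultiplicity⇒isEigenvalue 1 (λ ()) (hasMultiplicity-principal μ≈)

theorem5p1 :
    ∀ {c ℓ₁ ℓ₂ g ℓ} (F : HeytingField c ℓ₁ ℓ₂) → Matrices.CharacteristicZero F →
    (m : ℕ) → 2 ≤ m → (G : Group g ℓ) (q : ℕ) (order : HasOrder G q) →
    let open HeytingField F
        open Matrices F
        A = diagonalMatrix F G order m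
        eigenvalue = λ k → - ⟦ suc m ⟧ + ⟦ k ⟧ * ⟦ q ⟧
        principal = ⟦ suc m ⟧ * (⟦ q ⟧ - 1#)
        mult = λ k → multiplicity m k q {{order-nonZero G order}}
    in  (∀ k → k < m → ∃[ d ] (+ d) / 1 ≡ mult k × HasMultiplicity A (eigenvalue k) d)
      × HasMultiplicity A principal 1
      × (∀ μ → IsEigenvalue A μ ⇔ ((∃[ k ] k < m × mult k ≢ 0ℚ × μ ≈ eigenvalue k) ⊎ μ ≈ principal))
theorem5p1 F char0 m 2≤m G zero order = ⊥-elim (¬Fin0 (Inverse.from order (Group.ε G)))
theorem5p1 F char0 m 2≤m G (suc p) order =
    -- The `NonZero` argument of `multiplicity` is irrelevant, so the instance obtained from `order`
    -- and the one for `suc p` give the same number.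
    (λ k k<m → dim k , multiplicity-closed m k p , hasMultiplicity-≤ (ℕ.<⇒≤ k<m) refl)
  , hasMultiplicity-principal refl
  , λ μ → mk⇔ (isEigenvalue⇒ μ) (isEigenvalue⇐ μ)
  where
  open FieldProperties F using (refl)
  open Spectrum F char0 m 2≤m G p order
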